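{- Let $V$ be a finite set of size $n$, let $k\in\{0,\ldots,n\}$, and let $I,J\subseteq V$ be disjoint sets of size $i=\#I$ and $j=\#J$. Then \[ \deg p^{(V,k)}_{I,J}=\begin{cases} i+j-1 & \text{if } i+j \text{ is odd and } i+j\le \min(k,n-k),\\ k-1 & \text{if } k \text{ is odd and } n=2k \text{ and } i+j\ge k,\\ \min(i+j,k,n-k) & \text{otherwise.}\end{cases} \]
   Context: $\binom{V}{k}$ is the set of all $k$-element subsets of $V$; $A^\complement=V\setminus A$ for $A\subseteq V$. For $A\subseteq B\subseteq V$, the basic function $f^{(V,k)}_{A,B}:\binom{V}{k}\to\mathbb{R}$ is the characteristic function of $\{K\in\binom{V}{k}\mid A\subseteq K\subseteq B\}$. For disjoint $I,J\subseteq V$, the paired function is $p^{(V,k)}_{I,J}=f^{(V,k)}_{I,J^\complement}+f^{(V,k)}_{J,I^\complement}$. For $T\subseteq V$ with $\#T=t$, the function $f^{(V,k)}_{T,V}$ is called a $t$-pencil. The degree $\deg(f)$ of a non-zero function $f:\binom{V}{k}\to\mathbb{R}$ is the smallest number $t$ such that $f$ is an $\mathbb{R}$-linear combination of $t$-pencils (equivalently, the minimum degree of a real polynomial in variables $X_a$, $a\in V$, whose evaluation at the $0/1$ characteristic vector of each $K\in\binom{V}{k}$ equals $f(K)$). The degree of the zero function is set to $-\infty$.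
   Formalization: The paired function is additionally assumed to be non-zero; otherwise the formula fails, since the degree is −∞ (e.g. n=2, k=1, I=V, J=∅). The real numbers are replaced by an arbitrary field of characteristic 0. -}

module Defs where

open import Algebra.Apartness.Bundles using (HeytingField; HeytingCommutativeRing)
open import Algebra.Bundles using (CommutativeRing)
import Algebra.Definitions.RawMonoid as RawMonoidDefs
open import Data.Bool.Base using (if_then_else_)
open import Data.Fin.Subset using (Subset; _∩_; ∁; ∣_∣; Empty; ⊤)
open import Data.Fin.Subset.Properties using (_⊆?_)
open import Data.Nat.Base using (ℕ; suc; _+_; _*_; _∸_; _⊓_; _≤_; parity)
open import Data.Nat.Properties using (_≟_; _≤?_)
open import Data.Parity.Base using (1ℙ)
import Data.Parity.Properties as Parity
open import Data.Product.Base using (Σ-syntax; ∃-syntax; _×_; _,_)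
open import Data.Vec.Functional using (Vector)
open import Level using (Level; _⊔_)
open import Relation.Binary.PropositionalEquality using (_≡_)
open import Relation.Nullary.Construct.Add.Infimum using (_₋; ⊥₋; [_])
open import Relation.Nullary.Decidable using (does; _×-dec_)
open import Relation.Nullary.Negation using (¬_)

private
  variable
    n k : ℕ

-- The k-element subsets of the n-element set V = Fin n.
KSubset : ℕ → ℕ → Set
KSubset n k = Σ[ K ∈ Subset n ] ∣ K ∣ ≡ k

Disjoint : Subset n → Subset n → Set
Disjoint I J = Empty (I ∩ J)

-- In the first two cases the number from which 1 is subtracted is odd, so
-- the truncated subtraction is exact.  The first two cases overlap only for
-- i + j = k, where they agree.
pairedDegree : (n k i j : ℕ) → ℕ
pairedDegree n k i j =
  if does ((parity (i + j) Parity.≟ 1ℙ) ×-dec (i + j ≤? k ⊓ (n ∸ k)))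
  then i + j ∸ 1
  else if does ((parity k Parity.≟ 1ℙ) ×-dec (n ≟ 2 * k) ×-dec (k ≤? i + j))
  then k ∸ 1
  else (i + j) ⊓ k ⊓ (n ∸ k)

-- The real numbers matter here only as a field of characteristic 0, so the
-- scalars are taken from an arbitrary such field F.  "Heyting field" is the
-- constructive notion of field that ℝ satisfies: elements apart from 0 are
-- invertible.
module _ {c ℓ₁ ℓ₂ : Level} (F : HeytingField c ℓ₁ ℓ₂) where

  private
    module F = HeytingField F
    module R = CommutativeRing
      (HeytingCommutativeRing.commutativeRing F.heytingCommutativeRing)
    module + = RawMonoidDefs R.+-rawMonoid

  CharacteristicZero : Set ℓ₂
  CharacteristicZero = ∀ m → (suc m +.× F.1#) F.# F.0#

  Func : ℕ → ℕ → Set c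
  Func n k = KSubset n k → F.Carrier

  IsZero : Func n k → Set ℓ₁
  IsZero f = ∀ K → f K F.≈ F.0#

  basic : ∀ k → Subset n → Subset n → Func n k
  basic k A B (K , _) =
    if does ((A ⊆? K) ×-dec (K ⊆? B)) then F.1# else F.0#

  paired : ∀ k → Subset n → Subset n → Func n k
  paired k I J K = basic k I (∁ J) K F.+ basic k J (∁ I) K

  pencil : ∀ {t} k → KSubset n t → Func n k
  pencil k (T , _) = basic k T ⊤

  IsPencilCombination : ℕ → Func n k → Set (c ⊔ ℓ₁)
  IsPencilCombination {n} {k} t f =
    ∃[ m ] Σ[ a ∈ Vector F.Carrier m ] Σ[ T ∈ Vector (KSubset n t) m ]
      (∀ K → f K F.≈ +.sum (λ s → a s F.* pencil k (T s) K))

  -- HasDegree f d says deg f = d, where ⊥₋ is the degree −∞ of the zero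
  -- function.  It is a relation because equality in F need not be decidable.
  HasDegree : Func n k → ℕ ₋ → Set (c ⊔ ℓ₁)
  HasDegree f ⊥₋    = Level.Lift c (IsZero f)
  HasDegree f [ d ] =
    ¬ IsZero f × IsPencilCombination d f ×
    (∀ t → IsPencilCombination t f → d ≤ t)

{-# OPTIONS --safe #-}
module Submission where

-- Upper bound.  The term of degree i + j of f_{I,∁J} = ∏_{a∈I} x_a ∏_{b∈J} (1 − x_b) is
-- (−1)^j x^{I∪J}, so in p_{I,J} these terms cancel when i + j is odd.  Every function on the
-- slice is a combination of the indicators [K ⊆ L] = [L ⊆ K] of single points K, hence has
-- degree at most min(k, n − k).  If n = 2k, then p = p_{I,J} is invariant under complement,
-- so that 2p = Σ_K p(K) p_{K,∅}, where each p_{K,∅} has degree at most k − 1 if k is odd.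
--
-- Lower bound.  Up to exchanging I and J there is K with I ⊆ K ⊆ ∁J.  Choose d disjoint pairs
-- (a, b), a ∈ K, b ∉ K, with a ∈ I or b ∈ J.  The alternating sum over the 2^d sets obtained
-- from K by switching pairs kills all t-pencils with t < d.  On f_{I,∁J} it is 1, since only
-- K contributes; on f_{J,∁I} only the set with all pairs switched can contribute, with
-- sign (−1)^d.  So the sum of p is nonzero if d is even, or if some point of I ∪ J lies in no
-- pair, as then f_{J,∁I} does not contribute.

open import Algebra.Apartness.Bundles using (HeytingField; HeytingCommutativeRing)
open import Algebra.Bundles using (CommutativeRing)
import Algebra.Properties.CommutativeSemigroup as CommutativeSemigroupProperties
import Algebra.Properties.Group as GroupProperties
import Algebra.Properties.Monoid.Mult as MonoidMult
import Algebra.Properties.Monoid.Sum as MonoidSum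
import Algebra.Properties.Ring as RingProperties
open import Data.Bool.Base using (Bool; true; false; if_then_else_; not)
import Data.Bool.Properties as Bool
open import Data.Fin.Base using (Fin; zero; suc)
import Data.Fin.Properties as Fin
open import Data.Fin.Subset
  using (Subset; ⊤; ⊥; ∁; _∪_; _∩_; _-_; ⁅_⁆; _∈_; _∉_; _⊆_; ∣_∣; Nonempty)
open import Data.Fin.Subset.Properties
open import Data.Nat.Base as ℕ
  using (ℕ; zero; suc; _≤_; _<_; _∸_; _⊓_; z≤n; s≤s; parity)
import Data.Nat.Properties as ℕ
open import Data.Parity.Base using (0ℙ; 1ℙ)
import Data.Parity.Properties as Parity
open import Data.Product.Base using (∃; _×_; _,_; proj₁; proj₂)
open import Data.Sum.Base using (_⊎_; inj₁; inj₂; [_,_]′)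
open import Data.Vec.Base
  using (Vec; []; _∷_; here; there; head; tail; lookup; replicate; _[_]≔_)
import Data.Vec.Functional as Vector
open import Data.Vec.Properties
  using (∷-injectiveʳ; []=⇒lookup; lookup⇒[]=; lookup∘update; lookup∘update′; []≔-lookup)
open import Function.Base using (_∘_)
open import Function.Bundles using (mk⇔)
open import Level using (_⊔_)
open import Relation.Binary.Definitions using (tri<; tri≈; tri>)
open import Relation.Binary.PropositionalEquality as ≡ using (_≡_; _≢_)
import Relation.Binary.Reasoning.Setoid as SetoidReasoning
open import Relation.Nullary.Construct.Add.Infimum using ([_])
open import Relation.Nullary.Decidable using (Dec; does; does-⇔; _×-dec_; yes; no)
open import Relation.Nullary.Negation using (¬_; contradiction)
open import Defs

private
  variable
    n k d t : ℕ

-- Finite sets and the cases of the degree formula.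

⊆∧∣∣≡⇒≡ : (p q : Subset n) → p ⊆ q → ∣ p ∣ ≡ ∣ q ∣ → p ≡ q
⊆∧∣∣≡⇒≡ [] [] _ _ = ≡.refl
⊆∧∣∣≡⇒≡ (false ∷ p) (false ∷ q) p⊆q e =
  ≡.cong (false ∷_) (⊆∧∣∣≡⇒≡ p q (drop-∷-⊆ p⊆q) e)
⊆∧∣∣≡⇒≡ (false ∷ p) (true ∷ q) p⊆q e =
  contradiction (≡.subst (_≤ ∣ q ∣) e (p⊆q⇒∣p∣≤∣q∣ (drop-∷-⊆ p⊆q))) (ℕ.n≮n _)
⊆∧∣∣≡⇒≡ (true ∷ p) (false ∷ q) p⊆q e = contradiction (p⊆q here) λ ()
⊆∧∣∣≡⇒≡ (true ∷ p) (true ∷ q) p⊆q e =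
  ≡.cong (true ∷_) (⊆∧∣∣≡⇒≡ p q (drop-∷-⊆ p⊆q) (ℕ.suc-injective e))

∣p∪q∣≤∣p∣+∣q∣ : (p q : Subset n) → ∣ p ∪ q ∣ ≤ ∣ p ∣ ℕ.+ ∣ q ∣
∣p∪q∣≤∣p∣+∣q∣ [] [] = z≤n
∣p∪q∣≤∣p∣+∣q∣ (false ∷ p) (false ∷ q) = ∣p∪q∣≤∣p∣+∣q∣ p q
∣p∪q∣≤∣p∣+∣q∣ (false ∷ p) (true ∷ q) =
  ≡.subst (suc ∣ p ∪ q ∣ ≤_) (≡.sym (ℕ.+-suc _ _)) (s≤s (∣p∪q∣≤∣p∣+∣q∣ p q))
∣p∪q∣≤∣p∣+∣q∣ (true ∷ p) (y ∷ q) =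
  s≤s (ℕ.≤-trans (∣p∪q∣≤∣p∣+∣q∣ p q) (ℕ.+-monoʳ-≤ ∣ p ∣ (∣p∣≤∣x∷p∣ y q)))

∁-involutive : (p : Subset n) → ∁ (∁ p) ≡ p
∁-involutive [] = ≡.refl
∁-involutive (true ∷ p) = ≡.cong (true ∷_) (∁-involutive p)
∁-involutive (false ∷ p) = ≡.cong (false ∷_) (∁-involutive p)

∣p∪⁅x⁆∣ : (p : Subset n) (x : Fin n) → x ∉ p → ∣ p ∪ ⁅ x ⁆ ∣ ≡ suc ∣ p ∣
∣p∪⁅x⁆∣ (true ∷ p) zero x∉p = contradiction here x∉p
∣p∪⁅x⁆∣ {suc n} (false ∷ p) zero x∉p = ≡.cong (suc ∘ ∣_∣) (∪-identityʳ p)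
∣p∪⁅x⁆∣ (true ∷ p) (suc x) x∉p = ≡.cong suc (∣p∪⁅x⁆∣ p x (x∉p ∘ there))
∣p∪⁅x⁆∣ (false ∷ p) (suc x) x∉p = ∣p∪⁅x⁆∣ p x (x∉p ∘ there)

Disjoint-sym : {I J : Subset n} → Disjoint I J → Disjoint J I
Disjoint-sym {I = I} {J} = ≡.subst (λ p → ¬ ∃ (_∈ p)) (∩-comm I J)

∣⊥∣+∣∁p∣ : (p : Subset n) → ∣ p ∣ ≡ k → ∣ ⊥ {n} ∣ ℕ.+ ∣ ∁ p ∣ ≡ n ∸ k
∣⊥∣+∣∁p∣ {n = n} p ≡.refl = ≡.cong₂ ℕ._+_ (∣⊥∣≡0 n) (∣∁p∣≡n∸∣p∣ p)

Disjoint-⊥ˡ : (p : Subset n) → Disjoint ⊥ p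
Disjoint-⊥ˡ p (x , x∈) = ∉⊥ (proj₁ (x∈p∩q⁻ ⊥ p x∈))

if-elim : ∀ {a p} {A : Set a} (P : ℕ → Set p) (A? : Dec A) {x y : ℕ} →
          (A → P x) → (¬ A → P y) → P (if does A? then x else y)
if-elim P (yes a) px py = px a
if-elim P (no ¬a) px py = py ¬a

-- Serves both halves of the proof: `P` is instantiated once with the upper bound and once with the
-- lower bound. In the third case the failure of the first two conditions remains available.
pairedDegree-elim : ∀ {p} (P : ℕ → Set p) n k i j → let s = i ℕ.+ j in
  (parity s ≡ 1ℙ × s ≤ k ⊓ (n ∸ k) → P (s ∸ 1)) →
  (parity k ≡ 1ℙ × n ≡ 2 ℕ.* k × k ≤ s → P (k ∸ 1)) →
  (¬ (parity s ≡ 1ℙ × s ≤ k ⊓ (n ∸ k)) → ¬ (parity k ≡ 1ℙ × n ≡ 2 ℕ.* k × k ≤ s) →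
   P (s ⊓ k ⊓ (n ∸ k))) →
  P (pairedDegree n k i j)
pairedDegree-elim P n k i j p q r =
  if-elim P ((parity (i ℕ.+ j) Parity.≟ 1ℙ) ×-dec (i ℕ.+ j ℕ.≤? k ⊓ (n ∸ k))) p λ ¬p →
  if-elim P ((parity k Parity.≟ 1ℙ) ×-dec (n ℕ.≟ 2 ℕ.* k) ×-dec (k ℕ.≤? i ℕ.+ j)) q λ ¬q →
  r ¬p ¬q

pairedDegree-comm : ∀ n k i j → pairedDegree n k i j ≡ pairedDegree n k j i
pairedDegree-comm n k i j rewrite ℕ.+-comm i j = ≡.refl

⊓-elim : ∀ {p} (P : ℕ → Set p) m n → (m ≤ n → P m) → (n ≤ m → P n) → P (m ⊓ n)
⊓-elim P m n pm pn with ℕ.≤-total m n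
... | inj₁ m≤n = ≡.subst P (≡.sym (ℕ.m≤n⇒m⊓n≡m m≤n)) (pm m≤n)
... | inj₂ n≤m = ≡.subst P (≡.sym (ℕ.m≥n⇒m⊓n≡n n≤m)) (pn n≤m)

n≡2k⇒n∸k≡k : ∀ k → n ≡ 2 ℕ.* k → n ∸ k ≡ k
n≡2k⇒n∸k≡k k ≡.refl = ≡.trans (ℕ.m+n∸m≡n k (k ℕ.+ 0)) (ℕ.+-identityʳ k)

n∸k≡k⇒n≡2k : k ≤ n → k ≡ n ∸ k → n ≡ 2 ℕ.* k
n∸k≡k⇒n≡2k {k} {n} k≤n k≡n∸k =
  ≡.trans (≡.sym (ℕ.m+[n∸m]≡n k≤n))
    (≡.cong (k ℕ.+_) (≡.trans (≡.sym k≡n∸k) (≡.sym (ℕ.+-identityʳ k))))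

-- Oddness excludes `m = 0`, where truncated subtraction does not decrease.
odd⇒∸1< : ∀ {m} → parity m ≡ 1ℙ → m ∸ 1 < m
odd⇒∸1< {suc m} _ = ℕ.≤-refl

m≤d<m+n⇒0<n : ∀ {m n} → m ≤ d → d < m ℕ.+ n → 0 < n
m≤d<m+n⇒0<n {m = m} {zero} m≤d d<m+0 =
  contradiction (ℕ.≤-trans (≡.subst (_ <_) (ℕ.+-identityʳ m) d<m+0) m≤d) (ℕ.n≮n _)
m≤d<m+n⇒0<n {n = suc n} _ _ = s≤s z≤n

-- Removal of points, switches and disjoint pairs.

∉⇒lookup : {p : Subset n} {x : Fin n} → x ∉ p → lookup p x ≡ false
∉⇒lookup {p = p} {x} x∉p = Bool.¬-not (x∉p ∘ lookup⇒[]= x p)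

x∉p-x : (p : Subset n) (x : Fin n) → x ∉ p - x
x∉p-x (_ ∷ p) (suc x) (there x∈) = x∉p-x p x x∈

p-x⊆p : (p : Subset n) (x : Fin n) → p - x ⊆ p
p-x⊆p p x = p─q⊆p p ⁅ x ⁆

∣p∣≤1+∣p-x∣ : (p : Subset n) (x : Fin n) → ∣ p ∣ ≤ suc ∣ p - x ∣
∣p∣≤1+∣p-x∣ (true ∷ p) zero = s≤s (ℕ.≤-reflexive (≡.cong ∣_∣ (≡.sym (p─⊥≡p p))))
∣p∣≤1+∣p-x∣ (false ∷ p) zero = ℕ.m≤n⇒m≤1+n (ℕ.≤-reflexive (≡.cong ∣_∣ (≡.sym (p─⊥≡p p))))
∣p∣≤1+∣p-x∣ (true ∷ p) (suc x) = s≤s (∣p∣≤1+∣p-x∣ p x)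
∣p∣≤1+∣p-x∣ (false ∷ p) (suc x) = ∣p∣≤1+∣p-x∣ p x

d<∣p∣⇒d≤∣p-x∣ : (p : Subset n) (x : Fin n) → d < ∣ p ∣ → d ≤ ∣ p - x ∣
d<∣p∣⇒d≤∣p-x∣ p x d<∣p∣ = ℕ.s≤s⁻¹ (ℕ.≤-trans d<∣p∣ (∣p∣≤1+∣p-x∣ p x))

∣p∩q∣≤1+∣p-x∩q∣ : (p q : Subset n) (x : Fin n) → ∣ p ∩ q ∣ ≤ suc ∣ (p - x) ∩ q ∣
∣p∩q∣≤1+∣p-x∩q∣ p q x =
  ℕ.≤-trans (∣p∣≤1+∣p-x∣ (p ∩ q) x) (s≤s (p⊆q⇒∣p∣≤∣q∣ {q = (p - x) ∩ q} λ y∈ →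
    let y∈p , y∈q = x∈p∩q⁻ p q (p-x⊆p (p ∩ q) x y∈) in
    x∈p∩q⁺ (x∈p∧x≢y⇒x∈p-y y∈p (λ { ≡.refl → x∉p-x (p ∩ q) x y∈ }) , y∈q)))

x∉q⇒∣p∩q∣≤∣p-x∩q∣ : (p q : Subset n) (x : Fin n) → x ∉ q → ∣ p ∩ q ∣ ≤ ∣ (p - x) ∩ q ∣
x∉q⇒∣p∩q∣≤∣p-x∩q∣ p q x x∉q = p⊆q⇒∣p∣≤∣q∣ {q = (p - x) ∩ q} λ y∈ →
  let y∈p , y∈q = x∈p∩q⁻ p q y∈ in
  x∈p∩q⁺ (x∈p∧x≢y⇒x∈p-y y∈p (λ { ≡.refl → x∉q y∈q }) , y∈q)

p⊆q⇒∣p∣≤∣p∩q∣ : {p q : Subset n} → p ⊆ q → ∣ p ∣ ≤ ∣ p ∩ q ∣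
p⊆q⇒∣p∣≤∣p∩q∣ p⊆q = p⊆q⇒∣p∣≤∣q∣ λ y∈p → x∈p∩q⁺ (y∈p , p⊆q y∈p)

0<∣p∣⇒Nonempty : (p : Subset n) → 0 < ∣ p ∣ → Nonempty p
0<∣p∣⇒Nonempty {n} p 0<∣p∣ with nonempty? p
... | yes ne = ne
... | no ¬ne = contradiction
  (≡.subst (0 <_) (≡.trans (≡.cong ∣_∣ (Empty-unique ¬ne)) (∣⊥∣≡0 n)) 0<∣p∣) λ ()

∣p[x]≔false∣ : {p : Subset n} {x : Fin n} → x ∈ p → suc ∣ p [ x ]≔ false ∣ ≡ ∣ p ∣
∣p[x]≔false∣ here = ≡.refl
∣p[x]≔false∣ {p = true ∷ _} (there x∈p) = ≡.cong suc (∣p[x]≔false∣ x∈p)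
∣p[x]≔false∣ {p = false ∷ _} (there x∈p) = ∣p[x]≔false∣ x∈p

∣p[x]≔true∣ : (p : Subset n) (x : Fin n) → x ∉ p → ∣ p [ x ]≔ true ∣ ≡ suc ∣ p ∣
∣p[x]≔true∣ (true ∷ p) zero x∉p = contradiction here x∉p
∣p[x]≔true∣ (false ∷ p) zero x∉p = ≡.refl
∣p[x]≔true∣ (true ∷ p) (suc x) x∉p = ≡.cong suc (∣p[x]≔true∣ p x (x∉p ∘ there))
∣p[x]≔true∣ (false ∷ p) (suc x) x∉p = ∣p[x]≔true∣ p x (x∉p ∘ there)

-- For `a ∈ p` and `b ∉ p` the value `true` keeps the pair and `false` exchanges it. Overwriting
-- both coordinates, instead of negating them, makes the result independent of `a` and `b` in `p`.
switch : Fin n → Fin n → Bool → Subset n → Subset n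
switch a b x p = (p [ a ]≔ x) [ b ]≔ not x

lookup-switch : ∀ {a b v : Fin n} x p → v ≢ a → v ≢ b → lookup (switch a b x p) v ≡ lookup p v
lookup-switch x p v≢a v≢b =
  ≡.trans (lookup∘update′ v≢b (p [ _ ]≔ x) (not x)) (lookup∘update′ v≢a p x)

[]≔-id : ∀ (p : Subset n) {x y} → lookup p x ≡ y → p [ x ]≔ y ≡ p
[]≔-id p {x} ≡.refl = []≔-lookup p x

module _ {a b : Fin n} {p : Subset n} (a∈p : a ∈ p) (b∉p : b ∉ p) where

  private
    a≢b : a ≢ b
    a≢b ≡.refl = b∉p a∈p

  switch-true : switch a b true p ≡ p
  switch-true = ≡.trans (≡.cong (_[ b ]≔ false) ([]≔-id p ([]=⇒lookup a∈p)))
                        ([]≔-id p (∉⇒lookup b∉p))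

  ∣switch∣ : ∀ x → ∣ switch a b x p ∣ ≡ ∣ p ∣
  ∣switch∣ true = ≡.cong ∣_∣ switch-true
  ∣switch∣ false = ≡.trans (∣p[x]≔true∣ (p [ a ]≔ false) b b∉) (∣p[x]≔false∣ a∈p)
    where
    b∉ : b ∉ p [ a ]≔ false
    b∉ b∈ = b∉p (lookup⇒[]= b p
      (≡.trans (≡.sym (lookup∘update′ (a≢b ∘ ≡.sym) p false)) ([]=⇒lookup b∈)))

  a∉switch-false : a ∉ switch a b false p
  a∉switch-false a∈ = contradiction (≡.trans (≡.sym ([]=⇒lookup a∈))
    (≡.trans (lookup∘update′ a≢b (p [ a ]≔ false) true) (lookup∘update a p false))) λ ()

  b∈switch-false : b ∈ switch a b false p
  b∈switch-false = lookup⇒[]= b _ (lookup∘update b (p [ a ]≔ false) true)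

-- C and D consist of the points still available, which keeps the pairs disjoint.
data Pairing {n} (I J : Subset n) : Subset n → Subset n → ℕ → Set where
  done : ∀ {C D} → Pairing I J C D 0
  pair : ∀ {C D d} a b → a ∈ C → b ∈ D → a ∈ I ⊎ b ∈ J →
         Pairing I J (C - a) (D - b) d → Pairing I J C D (suc d)

-- Greedy choice. Call the points of `C ∩ I` and `D ∩ J` marked; every pair needs a marked point. A
-- pair with exactly one marked point lowers the number of marks by one, which leaves enough of
-- them. If there is no such pair, then `C ⊆ I` and `D ⊆ J`.
pairing : ∀ {n} d (I J C D : Subset n) → d ≤ ∣ C ∣ → d ≤ ∣ D ∣ →
          d ≤ ∣ C ∩ I ∣ ℕ.+ ∣ D ∩ J ∣ → Pairing I J C D d
pairing zero I J C D _ _ _ = done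
pairing {n} (suc d) I J C D d<∣C∣ d<∣D∣ d<marks = choose
  where
  rest : ∀ a b → d ≤ ∣ (C - a) ∩ I ∣ ℕ.+ ∣ (D - b) ∩ J ∣ → Pairing I J (C - a) (D - b) d
  rest a b = pairing d I J _ _ (d<∣p∣⇒d≤∣p-x∣ C a d<∣C∣) (d<∣p∣⇒d≤∣p-x∣ D b d<∣D∣)

  C≠∅ : Nonempty C
  C≠∅ = 0<∣p∣⇒Nonempty C (ℕ.m<n⇒0<n d<∣C∣)

  D≠∅ : Nonempty D
  D≠∅ = 0<∣p∣⇒Nonempty D (ℕ.m<n⇒0<n d<∣D∣)

  D∩J≠∅ : ∣ C ∩ I ∣ ≡ 0 → Nonempty (D ∩ J)
  D∩J≠∅ e = 0<∣p∣⇒Nonempty (D ∩ J)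
    (ℕ.m<n⇒0<n (≡.subst (λ m → d < m ℕ.+ ∣ D ∩ J ∣) e d<marks))

  pairˡ : ∀ {a b} → a ∈ C → a ∈ I → b ∈ D → b ∉ J → Pairing I J C D (suc d)
  pairˡ {a} {b} a∈C a∈I b∈D b∉J = pair a b a∈C b∈D (inj₁ a∈I) (rest a b
    (ℕ.s≤s⁻¹ (ℕ.≤-trans d<marks
      (ℕ.+-mono-≤ (∣p∩q∣≤1+∣p-x∩q∣ C I a) (x∉q⇒∣p∩q∣≤∣p-x∩q∣ D J b b∉J)))))

  pairʳ : ∀ {a b} → a ∈ C → a ∉ I → b ∈ D → b ∈ J → Pairing I J C D (suc d)
  pairʳ {a} {b} a∈C a∉I b∈D b∈J = pair a b a∈C b∈D (inj₂ b∈J) (rest a b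
    (ℕ.s≤s⁻¹ (ℕ.≤-trans d<marks (ℕ.≤-trans
      (ℕ.+-mono-≤ (x∉q⇒∣p∩q∣≤∣p-x∩q∣ C I a a∉I) (∣p∩q∣≤1+∣p-x∩q∣ D J b))
      (ℕ.≤-reflexive (ℕ.+-suc _ _))))))

  -- This pair may use up two marks, but at least `d` points are left in `C`, all of them marked.
  pairˡʳ : C ⊆ I → Pairing I J C D (suc d)
  pairˡʳ C⊆I with a , a∈C ← C≠∅ with b , b∈D ← D≠∅ =
    pair a b a∈C b∈D (inj₁ (C⊆I a∈C)) (rest a b
      (ℕ.≤-trans (d<∣p∣⇒d≤∣p-x∣ C a d<∣C∣)
        (ℕ.≤-trans (p⊆q⇒∣p∣≤∣p∩q∣ (C⊆I ∘ p-x⊆p C a)) (ℕ.m≤m+n _ _))))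

  choose : Pairing I J C D (suc d)
  choose with nonempty? (D ∩ ∁ J) | nonempty? (C ∩ I) | nonempty? (C ∩ ∁ I)
  ... | yes (b , b∈D∖J) | yes (a , a∈C∩I) | _ =
    let b∈D , b∈∁J = x∈p∩q⁻ D (∁ J) b∈D∖J
        a∈C , a∈I = x∈p∩q⁻ C I a∈C∩I
    in pairˡ a∈C a∈I b∈D (x∈∁p⇒x∉p b∈∁J)
  ... | yes _ | no C∩I=∅ | _ =
    let a , a∈C = C≠∅
        b , b∈D∩J = D∩J≠∅ (≡.trans (≡.cong ∣_∣ (Empty-unique C∩I=∅)) (∣⊥∣≡0 n))
        b∈D , b∈J = x∈p∩q⁻ D J b∈D∩J
    in pairʳ a∈C (λ a∈I → C∩I=∅ (a , x∈p∩q⁺ (a∈C , a∈I))) b∈D b∈J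
  ... | no D⊆J | _ | yes (a , a∈C∖I) =
    let b , b∈D = D≠∅
        a∈C , a∈∁I = x∈p∩q⁻ C (∁ I) a∈C∖I
    in pairʳ a∈C (x∈∁p⇒x∉p a∈∁I) b∈D
         (x∉∁p⇒x∈p λ b∈∁J → D⊆J (b , x∈p∩q⁺ (b∈D , b∈∁J)))
  ... | no _ | _ | no C⊆I =
    pairˡʳ λ a∈C → x∉∁p⇒x∈p λ a∈∁I → C⊆I (_ , x∈p∩q⁺ (a∈C , a∈∁I))

-- The `2^d` sets of the alternating sum. If `K` contains `C` and avoids `D`, then the constant
-- vector `true` gives `K`, and the constant vector `false` switches all pairs.
points : ∀ {I J C D : Subset n} → Subset n → Pairing I J C D d → Vec Bool d → Subset n
points K done [] = K
points K (pair a b _ _ _ p) (x ∷ σ) = switch a b x (points K p σ)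

lookup-points : ∀ {I J C D : Subset n} {K v} (p : Pairing I J C D d) σ →
                v ∉ C → v ∉ D → lookup (points K p σ) v ≡ lookup K v
lookup-points done [] _ _ = ≡.refl
lookup-points {C = C} {D} {K} (pair a b a∈C b∈D _ p) (x ∷ σ) v∉C v∉D =
  ≡.trans (lookup-switch x (points K p σ) (λ { ≡.refl → v∉C a∈C }) (λ { ≡.refl → v∉D b∈D }))
          (lookup-points p σ (v∉C ∘ p-x⊆p C a) (v∉D ∘ p-x⊆p D b))

∈-points : ∀ {I J C D K : Subset n} {v} (p : Pairing I J C D d) σ →
           v ∉ C → v ∉ D → v ∈ K → v ∈ points K p σ
∈-points {K = K} p σ v∉C v∉D v∈K =
  lookup⇒[]= _ (points K p σ) (≡.trans (lookup-points p σ v∉C v∉D) ([]=⇒lookup v∈K))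

∉-points : ∀ {I J C D K : Subset n} {v} (p : Pairing I J C D d) σ →
           v ∉ C → v ∉ D → v ∉ K → v ∉ points K p σ
∉-points {K = K} p σ v∉C v∉D v∉K v∈ = v∉K
  (lookup⇒[]= _ K (≡.trans (≡.sym (lookup-points p σ v∉C v∉D)) ([]=⇒lookup v∈)))

Separates : Subset n → Subset n → Subset n → Set
Separates K C D = (∀ {v} → v ∈ C → v ∈ K) × (∀ {v} → v ∈ D → v ∉ K)

module _ {C D K : Subset n} (sep : Separates K C D) where

  Separates-remove : ∀ a b → Separates K (C - a) (D - b)
  Separates-remove a b = proj₁ sep ∘ p-x⊆p C a , proj₂ sep ∘ p-x⊆p D b

  module _ {I J : Subset n} {a b : Fin n} (a∈C : a ∈ C) (b∈D : b ∈ D)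
           (p : Pairing I J (C - a) (D - b) d) (σ : Vec Bool d) where

    -- The remaining pairs do not touch `a`: it has been removed from `C`, and it is not in `D`
    -- because `C` lies inside and `D` outside `K`.
    pair-∈ : a ∈ points K p σ
    pair-∈ = ∈-points p σ (x∉p-x C a)
      (λ a∈D → proj₂ sep (p-x⊆p D b a∈D) (proj₁ sep a∈C)) (proj₁ sep a∈C)

    pair-∉ : b ∉ points K p σ
    pair-∉ = ∉-points p σ (λ b∈C → proj₂ sep b∈D (proj₁ sep (p-x⊆p C a b∈C)))
      (x∉p-x D b) (proj₂ sep b∈D)

∣points∣ : ∀ {I J C D K : Subset n} → Separates K C D → (p : Pairing I J C D d) →
           ∀ σ → ∣ points K p σ ∣ ≡ ∣ K ∣
∣points∣ _ done [] = ≡.refl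
∣points∣ sep (pair a b a∈C b∈D _ p) (x ∷ σ) =
  ≡.trans (∣switch∣ (pair-∈ sep a∈C b∈D p σ) (pair-∉ sep a∈C b∈D p σ) x)
          (∣points∣ (Separates-remove sep a b) p σ)

-- An unswitched pair leaves a in the set and b outside it.
violation : ∀ {I J C D K : Subset n} → Separates K C D → (p : Pairing I J C D d) →
  ∀ σ → σ ≢ replicate d false →
  ∃ λ v → (v ∈ C ⊎ v ∈ D) × (v ∈ I × v ∈ points K p σ ⊎ v ∈ J × v ∉ points K p σ)
violation sep done [] σ≢ = contradiction ≡.refl σ≢
violation {K = K} sep (pair a b a∈C b∈D mark p) (true ∷ σ) _
  rewrite switch-true (pair-∈ sep a∈C b∈D p σ) (pair-∉ sep a∈C b∈D p σ) with mark
... | inj₁ a∈I = a , inj₁ a∈C , inj₁ (a∈I , pair-∈ sep a∈C b∈D p σ)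
... | inj₂ b∈J = b , inj₂ b∈D , inj₂ (b∈J , pair-∉ sep a∈C b∈D p σ)
-- If the first pair is switched, an unswitched one comes later. That its point `v` stems from the
-- reduced `C` or `D` shows `v ≢ a` and `v ≢ b`, so the switch of the first pair does not affect
-- `v`.
violation {C = C} {D} {K} sep (pair a b a∈C b∈D _ p) (false ∷ σ) σ≢
  with violation (Separates-remove sep a b) p σ (σ≢ ∘ ≡.cong (false ∷_))
... | v , v∈C⊎D , viol = v , v∈ v∈C⊎D , transport viol
  where
  v∈ : v ∈ C - a ⊎ v ∈ D - b → v ∈ C ⊎ v ∈ D
  v∈ (inj₁ v∈C) = inj₁ (p-x⊆p C a v∈C)
  v∈ (inj₂ v∈D) = inj₂ (p-x⊆p D b v∈D)
  v≢a : v ∈ C - a ⊎ v ∈ D - b → v ≢ a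
  v≢a (inj₁ v∈C) ≡.refl = x∉p-x C a v∈C
  v≢a (inj₂ v∈D) ≡.refl = proj₂ sep (p-x⊆p D b v∈D) (proj₁ sep a∈C)
  v≢b : v ∈ C - a ⊎ v ∈ D - b → v ≢ b
  v≢b (inj₁ v∈C) ≡.refl = proj₂ sep b∈D (proj₁ sep (p-x⊆p C a v∈C))
  v≢b (inj₂ v∈D) ≡.refl = x∉p-x D b v∈D
  same : lookup (switch a b false (points K p σ)) v ≡ lookup (points K p σ) v
  same = lookup-switch false (points K p σ) (v≢a v∈C⊎D) (v≢b v∈C⊎D)
  transport : v ∈ _ × v ∈ points K p σ ⊎ v ∈ _ × v ∉ points K p σ →
              v ∈ _ × v ∈ switch a b false (points K p σ) ⊎
              v ∈ _ × v ∉ switch a b false (points K p σ)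
  transport (inj₁ (v∈I , v∈)) = inj₁ (v∈I , lookup⇒[]= v _ (≡.trans same ([]=⇒lookup v∈)))
  transport (inj₂ (v∈J , v∉)) =
    inj₂ (v∈J , λ v∈ → v∉ (lookup⇒[]= v _ (≡.trans (≡.sym same) ([]=⇒lookup v∈))))

module Degree {c ℓ₁ ℓ₂} (F : HeytingField c ℓ₁ ℓ₂) (char0 : CharacteristicZero F) where

  open HeytingField F using (#⇒invertible; #-irrefl)
  open CommutativeRing
    (HeytingCommutativeRing.commutativeRing (HeytingField.heytingCommutativeRing F))
    hiding (_-_; zero)
  open MonoidSum +-monoid using (sum; sum-cong-≋; sum-replicate-zero)
  open MonoidMult +-monoid
    using (×-homo-+) renaming (_×_ to infixr 8 _·_)
  open RingProperties ring using (-‿distribˡ-*; -‿distribʳ-*; -1*x≈-x; -‿+-comm)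
  open GroupProperties +-group
    using () renaming (⁻¹-involutive to -‿involutive; ε⁻¹≈ε to -0#≈0#; ∙-cancelˡ to +-cancelˡ)
  open CommutativeSemigroupProperties +-commutativeSemigroup
    using () renaming (interchange to +-interchange; x∙yz≈y∙xz to x+[y+z]≈y+[x+z])
  open CommutativeSemigroupProperties *-commutativeSemigroup using (x∙yz≈y∙xz)
  open SetoidReasoning setoid

  -- Integers, signs and basic functions over the field.

  ·-zeroʳ : ∀ m → m · 0# ≈ 0#
  ·-zeroʳ zero = refl
  ·-zeroʳ (suc m) = trans (+-identityˡ _) (·-zeroʳ m)

  ·-*-assoc : ∀ m x → (m · 1#) * x ≈ m · x
  ·-*-assoc zero x = zeroˡ x
  ·-*-assoc (suc m) x = trans (distribʳ x 1# (m · 1#)) (+-cong (*-identityˡ x) (·-*-assoc m x))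

  suc-invertible : ∀ m → ∃ λ y → ∀ x → y * (suc m · x) ≈ x
  suc-invertible m with y , inv , _ ← #⇒invertible (char0 m) = y , λ x → begin
    y * (suc m · x)            ≈⟨ *-congˡ (·-*-assoc (suc m) x) ⟨
    y * ((suc m · 1#) * x)     ≈⟨ *-assoc _ _ _ ⟨
    y * (suc m · 1#) * x       ≈⟨ *-congʳ (*-congˡ (trans (+-congˡ -0#≈0#) (+-identityʳ _))) ⟨
    -- Apartness of two elements makes their difference invertible, hence the subtraction of `0#`.
    y * (suc m · 1# + - 0#) * x  ≈⟨ *-congʳ inv ⟩
    1# * x                     ≈⟨ *-identityˡ x ⟩
    x                          ∎

  sgn : ℕ → Carrier
  sgn zero = 1#
  sgn (suc m) = - sgn m

  even⇒sgn≈1 : ∀ m → parity m ≡ 0ℙ → sgn m ≈ 1#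
  even⇒sgn≈1 zero _ = refl
  even⇒sgn≈1 (suc (suc m)) e = trans (-‿involutive _) (even⇒sgn≈1 m e)

  -- Exactly one of the two exponents is odd. The signs will be the coefficients of the top monomial
  -- in the two summands of the paired function.
  odd⇒sgn-cancel : ∀ i j → parity (i ℕ.+ j) ≡ 1ℙ → sgn i + sgn j ≈ 0#
  odd⇒sgn-cancel zero (suc zero) _ = -‿inverseʳ 1#
  odd⇒sgn-cancel zero (suc (suc j)) e =
    trans (+-congˡ (-‿involutive _)) (odd⇒sgn-cancel zero j e)
  odd⇒sgn-cancel (suc zero) j e = trans (+-congˡ (even⇒sgn≈1 j (even j e))) (-‿inverseˡ 1#)
    where
    even : ∀ j → parity (suc j) ≡ 1ℙ → parity j ≡ 0ℙ
    even zero _ = ≡.refl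
    even (suc (suc j)) e = even j e
  odd⇒sgn-cancel (suc (suc i)) j e =
    trans (+-congʳ (-‿involutive _)) (odd⇒sgn-cancel i j e)

  -- `basic` as a function on all subsets, which permits recursion on the first point without
  -- tracking `k`.
  between : Subset n → Subset n → Subset n → Carrier
  between A B K = if does ((A ⊆? K) ×-dec (K ⊆? B)) then 1# else 0#

  between-true : ∀ {A B K : Subset n} → A ⊆ K → K ⊆ B → between A B K ≈ 1#
  between-true {A = A} {B} {K} A⊆K K⊆B with A ⊆? K | K ⊆? B
  ... | yes _ | yes _ = refl
  ... | yes _ | no ¬p = contradiction (λ {x} → K⊆B {x}) ¬p
  ... | no ¬p | _ = contradiction (λ {x} → A⊆K {x}) ¬p

  between-false : ∀ {A B K : Subset n} → ¬ (A ⊆ K × K ⊆ B) → between A B K ≈ 0#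
  between-false {A = A} {B} {K} ¬p with A ⊆? K | K ⊆? B
  ... | yes p | yes q = contradiction ((λ {x} → p {x}) , (λ {x} → q {x})) ¬p
  ... | yes _ | no _ = refl
  ... | no _ | _ = refl

  -- Pencil combinations

  Span : ∀ k → ℕ → (Subset n → Carrier) → Set (c ⊔ ℓ₁)
  Span {n} k t g = IsPencilCombination F {n} {k} t (g ∘ proj₁)

  private
    variable
      g h : Subset n → Carrier

  span-cong : (∀ K → ∣ K ∣ ≡ k → g K ≈ h K) → Span k t g → Span k t h
  span-cong g≈h (m , a , T , eq) =
    m , a , T , λ (K , ∣K∣≡k) → trans (sym (g≈h K ∣K∣≡k)) (eq (K , ∣K∣≡k))

  span-zero : Span {n} k t (λ _ → 0#)
  span-zero = 0 , (λ ()) , (λ ()) , λ _ → refl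

  span-term : ∀ a (T : KSubset n t) → Span k t g →
              Span k t (λ K → a * between (proj₁ T) ⊤ K + g K)
  span-term a T (m , as , Ts , eq) =
    suc m , (a Vector.∷ as) , (T Vector.∷ Ts) , λ K → +-congˡ (eq K)

  span-pencil : ∀ (T : Subset n) → Span k ∣ T ∣ (between T ⊤)
  span-pencil T =
    span-cong (λ _ _ → trans (+-identityʳ _) (*-identityˡ _))
      (span-term 1# (T , ≡.refl) span-zero)

  span-+ : Span k t g → Span k t h → Span k t (λ K → g K + h K)
  span-+ {k = k} {t = t} {h = h} (m , a , T , eq) sh =
    span-cong (λ K e → +-congʳ (sym (eq (K , e)))) (go m a T)
    where
    go : ∀ m (a : Vector.Vector Carrier m) (T : Vector.Vector (KSubset _ t) m) →
         Span k t (λ K → sum (λ s → a s * between (proj₁ (T s)) ⊤ K) + h K)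
    go zero a T = span-cong (λ _ _ → sym (+-identityˡ _)) sh
    go (suc m) a T =
      span-cong (λ _ _ → sym (+-assoc _ _ _))
        (span-term (a zero) (T zero) (go m (a ∘ suc) (T ∘ suc)))

  span-scale : ∀ a → Span k t g → Span k t (λ K → a * g K)
  span-scale {k = k} {t = t} a (m , as , Ts , eq) =
    span-cong (λ K e → *-congˡ (sym (eq (K , e)))) (go m as Ts)
    where
    go : ∀ m (as : Vector.Vector Carrier m) (T : Vector.Vector (KSubset _ t) m) →
         Span k t (λ K → a * sum (λ s → as s * between (proj₁ (T s)) ⊤ K))
    go zero as T = span-cong (λ _ _ → sym (zeroʳ a)) span-zero
    go (suc m) as T =
      span-cong (λ _ _ → trans (+-congʳ (*-assoc _ _ _)) (sym (distribˡ _ _ _)))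
        (span-term (a * as zero) (T zero) (go m (as ∘ suc) (T ∘ suc)))

  span-sum : ∀ m {h : Fin m → Subset n → Carrier} → (∀ i → Span k t (h i)) →
             Span k t (λ K → sum (λ i → h i K))
  span-sum zero _ = span-zero
  span-sum (suc m) sh = span-+ (sh zero) (span-sum m (sh ∘ suc))

  -- The monomial `x_a x^T` for a new point `a`. The default 0 for `a ∈ T` makes every non-zero term
  -- a pencil of degree exactly `∣ T ∣ + 1`.
  extend : (T : Subset n) → Fin n → Subset n → Carrier
  extend T a K = if does (a ∈? T) then 0# else between (T ∪ ⁅ a ⁆) ⊤ K

  -- This is Σ_a x_a x^T = |K| x^T, where each a ∈ T contributes x^T to the left side.
  sum-extend : (T K : Subset n) →
    ∣ T ∣ · between T ⊤ K + sum (λ a → extend T a K) ≈ ∣ K ∣ · between T ⊤ K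
  sum-extend [] [] = +-identityʳ _
  sum-extend (true ∷ T) (true ∷ K) = begin
    b + ∣ T ∣ · b + (0# + s)  ≈⟨ +-cong refl (+-identityˡ s) ⟩
    b + ∣ T ∣ · b + s         ≈⟨ +-assoc _ _ _ ⟩
    b + (∣ T ∣ · b + s)       ≈⟨ +-congˡ (sum-extend T K) ⟩
    b + ∣ K ∣ · b             ∎
    where
    b = between T ⊤ K
    s = sum (λ a → extend T a K)
  sum-extend {suc n} (true ∷ T) (false ∷ K) = begin
    suc ∣ T ∣ · 0# + (0# + s)  ≈⟨ +-cong (·-zeroʳ (suc ∣ T ∣)) (+-identityˡ s) ⟩
    0# + s                     ≈⟨ +-identityˡ s ⟩
    s                          ≈⟨ sum-cong-≋ (λ a → vanish (does (a ∈? T))) ⟩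
    sum (λ (_ : Fin n) → 0#)   ≈⟨ sum-replicate-zero n ⟩
    0#                         ≈⟨ ·-zeroʳ ∣ K ∣ ⟨
    ∣ K ∣ · 0#                 ∎
    where
    s = sum (λ a → extend (true ∷ T) (suc a) (false ∷ K))
    vanish : ∀ b → (if b then 0# else 0#) ≈ 0#
    vanish true = refl
    vanish false = refl
  sum-extend (false ∷ T) (false ∷ K) =
    trans (+-congˡ (+-identityˡ _)) (sum-extend T K)
  -- The new point `zero` lies in `K`, so its term is `b`, the additional summand on the right. The
  -- rewrite simplifies the `T ∪ ⊥` in this term.
  sum-extend {suc n} (false ∷ T) (true ∷ K) rewrite ∪-identityʳ T = begin
    ∣ T ∣ · b + (b + s)  ≈⟨ x+[y+z]≈y+[x+z] _ _ _ ⟩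
    b + (∣ T ∣ · b + s)  ≈⟨ +-congˡ (sum-extend T K) ⟩
    b + ∣ K ∣ · b        ∎
    where
    b = between T ⊤ K
    s = sum (λ a → extend T a K)

  span-extend : ∀ (T : Subset n) a → Span k (suc ∣ T ∣) (extend T a)
  span-extend {k = k} T a with a ∈? T
  ... | yes _ = span-zero
  ... | no a∉T =
    ≡.subst (λ t → Span k t (between (T ∪ ⁅ a ⁆) ⊤)) (∣p∪⁅x⁆∣ T a a∉T) (span-pencil (T ∪ ⁅ a ⁆))

  -- On the slice, `sum-extend` says that the monomials `x_a x^T` with `a` new add up to
  -- `(k - ∣ T ∣) x^T`, and this positive integer can be divided out.
  span-pencil-suc : (T : Subset n) → ∣ T ∣ < k → Span k (suc ∣ T ∣) (between T ⊤)
  span-pencil-suc {n = n} {k = k} T ∣T∣<k with y , inv ← suc-invertible (k ∸ suc ∣ T ∣) =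
    span-cong count (span-scale y (span-sum n (span-extend T)))
    where
    -- One less than `k - ∣ T ∣`, so that the divisor has the form `suc m`.
    m = k ∸ suc ∣ T ∣
    count : ∀ K → ∣ K ∣ ≡ k → y * sum (λ a → extend T a K) ≈ between T ⊤ K
    count K ∣K∣≡k = trans (*-congˡ (+-cancelˡ (∣ T ∣ · b) _ _ (begin
      ∣ T ∣ · b + sum (λ a → extend T a K)  ≈⟨ sum-extend T K ⟩
      ∣ K ∣ · b                             ≡⟨ ≡.cong (_· b) (≡.trans ∣K∣≡k (≡.sym (≡.trans (ℕ.+-suc ∣ T ∣ m) (ℕ.m+[n∸m]≡n ∣T∣<k)))) ⟩
      (∣ T ∣ ℕ.+ suc m) · b                 ≈⟨ ×-homo-+ b ∣ T ∣ (suc m) ⟩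
      ∣ T ∣ · b + suc m · b                 ∎))) (inv b)
      where b = between T ⊤ K

  span-suc : t < k → Span {n} k t g → Span k (suc t) g
  span-suc {t = t} {k = k} t<k (m , a , T , eq) =
    span-cong (λ K e → sym (eq (K , e))) (span-sum m λ s → span-scale (a s) (lift (T s)))
    where
    lift : (T : KSubset _ t) → Span k (suc t) (between (proj₁ T) ⊤)
    lift (T , ≡.refl) = span-pencil-suc T t<k

  -- Pencil combinations are homogeneous, so the degree is raised one step at a time. Beyond `k` all
  -- pencils vanish on the slice, whence the bound on `u`.
  span-mono : ∀ {t u} → t ≤ u → u ≤ k → Span {n} k t g → Span k u g
  span-mono t≤u = go (ℕ.≤⇒≤′ t≤u)
    where
    go : ∀ {t u} → t ℕ.≤′ u → u ≤ k → Span {n} k t g → Span k u g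
    go (ℕ.≤′-reflexive ≡.refl) _ sg = sg
    go (ℕ.≤′-step t≤u) u<k sg = span-suc u<k (go t≤u (ℕ.<⇒≤ u<k) sg)

  -- Polynomials in the indicators of the points

  ⟦_⟧ : Bool → Carrier
  ⟦ b ⟧ = if b then 1# else 0#

  -- Polynomial functions on the whole cube, with terms of mixed degrees. The bound is strict so
  -- that `d = 0` leaves only the zero function, as the remainder below requires for empty `I` and
  -- `J`.
  data DegreeBelow {n} (d : ℕ) : (Subset n → Carrier) → Set (c ⊔ ℓ₁) where
    mono  : ∀ T → ∣ T ∣ < d → DegreeBelow d (between T ⊤)
    null  : DegreeBelow d (λ _ → 0#)
    add   : DegreeBelow d g → DegreeBelow d h → DegreeBelow d (λ K → g K + h K)
    scale : ∀ a → DegreeBelow d g → DegreeBelow d (λ K → a * g K)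
    resp  : (∀ K → g K ≈ h K) → DegreeBelow d g → DegreeBelow d h

  DegreeBelow-mono : ∀ {d e} → d ≤ e → DegreeBelow d g → DegreeBelow e g
  DegreeBelow-mono d≤e (mono T ∣T∣<d) = mono T (ℕ.≤-trans ∣T∣<d d≤e)
  DegreeBelow-mono d≤e null = null
  DegreeBelow-mono d≤e (add p q) = add (DegreeBelow-mono d≤e p) (DegreeBelow-mono d≤e q)
  DegreeBelow-mono d≤e (scale a p) = scale a (DegreeBelow-mono d≤e p)
  DegreeBelow-mono d≤e (resp g≈h p) = resp g≈h (DegreeBelow-mono d≤e p)

  ignore-head : DegreeBelow d g → DegreeBelow d (g ∘ tail)
  ignore-head (mono T ∣T∣<d) =
    resp (λ { (true ∷ _) → refl ; (false ∷ _) → refl }) (mono (false ∷ T) ∣T∣<d)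
  ignore-head null = null
  ignore-head (add p q) = add (ignore-head p) (ignore-head q)
  ignore-head (scale a p) = scale a (ignore-head p)
  ignore-head (resp g≈h p) = resp (g≈h ∘ tail) (ignore-head p)

  times-head : DegreeBelow d g → DegreeBelow (suc d) (λ K → ⟦ head K ⟧ * g (tail K))
  times-head (mono T ∣T∣<d) =
    resp (λ { (true ∷ _) → sym (*-identityˡ _) ; (false ∷ _) → sym (zeroˡ _) })
      (mono (true ∷ T) (s≤s ∣T∣<d))
  times-head null = resp (λ K → sym (zeroʳ _)) null
  times-head (add p q) =
    resp (λ K → sym (distribˡ _ _ _)) (add (times-head p) (times-head q))
  times-head (scale a p) =
    resp (λ K → x∙yz≈y∙xz a ⟦ head K ⟧ _) (scale a (times-head p))
  times-head (resp g≈h p) = resp (λ K → *-congˡ (g≈h (tail K))) (times-head p)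

  -- Homogenization: on the slice every monomial of degree at most `d` is a combination of
  -- `d`-pencils.
  span-DegreeBelow : d ≤ k → DegreeBelow (suc d) g → Span k d g
  span-DegreeBelow d≤k (mono T (s≤s ∣T∣≤d)) = span-mono ∣T∣≤d d≤k (span-pencil T)
  span-DegreeBelow d≤k null = span-zero
  span-DegreeBelow d≤k (add p q) = span-+ (span-DegreeBelow d≤k p) (span-DegreeBelow d≤k q)
  span-DegreeBelow d≤k (scale a p) = span-scale a (span-DegreeBelow d≤k p)
  span-DegreeBelow d≤k (resp g≈h p) = span-cong (λ K _ → g≈h K) (span-DegreeBelow d≤k p)

  -0*x : ∀ x → - 1# * (0# * x) ≈ 0#
  -0*x x = trans (*-congˡ (zeroˡ x)) (zeroʳ _)

  -- Expanding ∏_{a∈I} x_a ∏_{b∈J} (1 − x_b), the only term of degree |I| + |J| is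
  -- (−1)^|J| ∏_{a∈I∪J} x_a.
  DegreeBelow-remainder : (I J : Subset n) → Disjoint I J →
    DegreeBelow (∣ I ∣ ℕ.+ ∣ J ∣)
      (λ K → between I (∁ J) K + - (sgn ∣ J ∣ * between (I ∪ J) ⊤ K))
  DegreeBelow-between : (I J : Subset n) → Disjoint I J →
    DegreeBelow (suc (∣ I ∣ ℕ.+ ∣ J ∣)) (between I (∁ J))

  DegreeBelow-remainder [] [] _ =
    resp (λ { [] → sym (trans (+-congˡ (-‿cong (*-identityˡ 1#))) (-‿inverseʳ 1#)) }) null
  DegreeBelow-remainder (true ∷ I) (true ∷ J) I#J = contradiction (zero , here) I#J
  DegreeBelow-remainder (true ∷ I) (false ∷ J) I#J =
    resp (λ { (true ∷ K) → *-identityˡ _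
            ; (false ∷ K) → trans (zeroˡ _) (sym (trans (+-identityˡ _)
                                (trans (-‿cong (zeroʳ _)) -0#≈0#))) })
      (times-head (DegreeBelow-remainder I J (drop-∷-Empty I#J)))
  DegreeBelow-remainder (false ∷ I) (false ∷ J) I#J =
    resp (λ { (true ∷ K) → refl ; (false ∷ K) → refl })
      (ignore-head (DegreeBelow-remainder I J (drop-∷-Empty I#J)))
  -- Let `f` be the basic function on the remaining points and `s m` its top term. The new basic
  -- function is `(1 - x_0) f` with top term `- s x_0 m`, and `(1 - x_0) f + s x_0 m = f - x_0 (f -
  -- s m)`, in which both parts have small enough degree.
  DegreeBelow-remainder (false ∷ I) (true ∷ J) I#J =
    DegreeBelow-mono (ℕ.≤-reflexive (≡.sym (ℕ.+-suc ∣ I ∣ ∣ J ∣)))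
      (resp eq (add (ignore-head (DegreeBelow-between I J I#J′))
                    (scale (- 1#) (times-head (DegreeBelow-remainder I J I#J′)))))
    where
    I#J′ = drop-∷-Empty I#J
    s = sgn ∣ J ∣
    eq : ∀ K →
      between I (∁ J) (tail K) +
        - 1# * (⟦ head K ⟧ * (between I (∁ J) (tail K) + - (s * between (I ∪ J) ⊤ (tail K)))) ≈
      between (false ∷ I) (∁ (true ∷ J)) K +
        - (- s * between ((false ∷ I) ∪ (true ∷ J)) ⊤ K)
    eq (true ∷ K) rewrite Bool.∧-zeroʳ (does (I ⊆? K)) = begin
      b + - 1# * (1# * (b + - (s * m)))  ≈⟨ +-congˡ (-1*x≈-x _) ⟩
      b + - (1# * (b + - (s * m)))       ≈⟨ +-congˡ (-‿cong (*-identityˡ _)) ⟩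
      b + - (b + - (s * m))              ≈⟨ +-congˡ (-‿+-comm _ _) ⟨
      b + (- b + - - (s * m))            ≈⟨ +-assoc _ _ _ ⟨
      b + - b + - - (s * m)              ≈⟨ +-cong (-‿inverseʳ b) (-‿cong (-‿distribˡ-* s m)) ⟩
      0# + - (- s * m)                   ∎
      where
      b = between I (∁ J) K
      m = between (I ∪ J) ⊤ K
    eq (false ∷ K) =
      +-congˡ (trans (-0*x _) (sym (trans (-‿cong (zeroʳ _)) -0#≈0#)))

  -- The top term is added back to the remainder, which raises the strict bound by one.
  DegreeBelow-between I J I#J =
    resp (λ K → trans (+-assoc _ _ _) (trans (+-congˡ (-‿inverseˡ _)) (+-identityʳ _)))
      (add (DegreeBelow-mono (ℕ.n≤1+n _) (DegreeBelow-remainder I J I#J))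
           (scale (sgn ∣ J ∣) (mono (I ∪ J) (s≤s (∣p∪q∣≤∣p∣+∣q∣ I J)))))

  -- Upper bounds from polynomial expansion.

  pairedOn : Subset n → Subset n → Subset n → Carrier
  pairedOn I J K = between I (∁ J) K + between J (∁ I) K

  span-paired : (I J : Subset n) → Disjoint I J → ∣ I ∣ ℕ.+ ∣ J ∣ ≤ k →
                Span k (∣ I ∣ ℕ.+ ∣ J ∣) (pairedOn I J)
  span-paired I J I#J i+j≤k =
    span-DegreeBelow i+j≤k
      (add (DegreeBelow-between I J I#J)
           (DegreeBelow-mono (s≤s (ℕ.≤-reflexive (ℕ.+-comm ∣ J ∣ ∣ I ∣)))
             (DegreeBelow-between J I (Disjoint-sym {I = I} I#J))))

  -- The two summands share the top monomial of `I ∪ J`, with opposite coefficients, so the paired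
  -- function is the sum of the two remainders.
  DegreeBelow-paired-odd : (I J : Subset n) → Disjoint I J → parity (∣ I ∣ ℕ.+ ∣ J ∣) ≡ 1ℙ →
                           DegreeBelow (∣ I ∣ ℕ.+ ∣ J ∣) (pairedOn I J)
  DegreeBelow-paired-odd I J I#J odd =
    resp eq
      (add (DegreeBelow-remainder I J I#J)
           (DegreeBelow-mono (ℕ.≤-reflexive (ℕ.+-comm ∣ J ∣ ∣ I ∣))
             (DegreeBelow-remainder J I (Disjoint-sym {I = I} I#J))))
    where
    eq : ∀ K →
      (between I (∁ J) K + - (sgn ∣ J ∣ * between (I ∪ J) ⊤ K)) +
      (between J (∁ I) K + - (sgn ∣ I ∣ * between (J ∪ I) ⊤ K)) ≈ pairedOn I J K
    eq K rewrite ∪-comm J I = begin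
      (x + - (sj * m)) + (y + - (si * m))  ≈⟨ +-interchange _ _ _ _ ⟩
      x + y + (- (sj * m) + - (si * m))    ≈⟨ +-congˡ (-‿+-comm _ _) ⟩
      x + y + - (sj * m + si * m)          ≈⟨ +-congˡ (-‿cong (distribʳ m sj si)) ⟨
      x + y + - ((sj + si) * m)            ≈⟨ +-congˡ (-‿cong (*-congʳ (odd⇒sgn-cancel ∣ J ∣ ∣ I ∣ odd′))) ⟩
      x + y + - (0# * m)                   ≈⟨ +-congˡ (trans (-‿cong (zeroˡ m)) -0#≈0#) ⟩
      x + y + 0#                           ≈⟨ +-identityʳ _ ⟩
      x + y                                ∎
      where
      x = between I (∁ J) K
      y = between J (∁ I) K
      m = between (I ∪ J) ⊤ K
      si = sgn ∣ I ∣
      sj = sgn ∣ J ∣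
      odd′ = ≡.trans (≡.cong parity (ℕ.+-comm ∣ J ∣ ∣ I ∣)) odd

  span-paired-odd : (I J : Subset n) → Disjoint I J → parity (∣ I ∣ ℕ.+ ∣ J ∣) ≡ 1ℙ →
                    ∣ I ∣ ℕ.+ ∣ J ∣ ≤ k → Span k (∣ I ∣ ℕ.+ ∣ J ∣ ∸ 1) (pairedOn I J)
  span-paired-odd I J I#J odd i+j≤k =
    go odd i+j≤k (DegreeBelow-paired-odd I J I#J odd)
    where
    -- An odd `d` is a successor, and degree below `d` then means degree at most `d ∸ 1`.
    go : ∀ {d} → parity d ≡ 1ℙ → d ≤ k → DegreeBelow d g → Span k (d ∸ 1) g
    go {d = suc d} _ d<k p = span-DegreeBelow (ℕ.<⇒≤ d<k) p

  -- Interpolation on the slice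

  subsetSum : (Subset n → Carrier) → Carrier
  subsetSum {zero} f = f []
  subsetSum {suc n} f = subsetSum (f ∘ (true ∷_)) + subsetSum (f ∘ (false ∷_))

  subsetSum-zero : (f : Subset n → Carrier) → (∀ K → f K ≈ 0#) → subsetSum f ≈ 0#
  subsetSum-zero {zero} f f≈0 = f≈0 []
  subsetSum-zero {suc n} f f≈0 =
    trans (+-cong (subsetSum-zero _ (f≈0 ∘ (true ∷_))) (subsetSum-zero _ (f≈0 ∘ (false ∷_))))
          (+-identityˡ 0#)

  subsetSum-single : (f : Subset n → Carrier) (L : Subset n) →
                     (∀ K → K ≢ L → f K ≈ 0#) → subsetSum f ≈ f L
  subsetSum-single f [] f≈0 = refl
  subsetSum-single f (true ∷ L) f≈0 =
    trans (+-cong (subsetSum-single _ L (λ K K≢L → f≈0 _ (K≢L ∘ ∷-injectiveʳ)))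
                  (subsetSum-zero _ (λ K → f≈0 (false ∷ K) λ ())))
          (+-identityʳ _)
  subsetSum-single f (false ∷ L) f≈0 =
    trans (+-cong (subsetSum-zero _ (λ K → f≈0 (true ∷ K) λ ()))
                  (subsetSum-single _ L (λ K K≢L → f≈0 _ (K≢L ∘ ∷-injectiveʳ))))
          (+-identityˡ _)

  subsetSum-span : ∀ {m} {f : Subset m → Subset n → Carrier} → (∀ K → Span k t (f K)) →
                   Span k t (λ L → subsetSum (λ K → f K L))
  subsetSum-span {m = zero} sf = sf []
  subsetSum-span {m = suc m} sf =
    span-+ (subsetSum-span (sf ∘ (true ∷_))) (subsetSum-span (sf ∘ (false ∷_)))

  subsetSum-+ : {f g h : Subset n → Carrier} → (∀ K → f K ≈ g K + h K) →
                subsetSum f ≈ subsetSum g + subsetSum h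
  subsetSum-+ {zero} f≈g+h = f≈g+h []
  subsetSum-+ {suc n} f≈g+h =
    trans (+-cong (subsetSum-+ (f≈g+h ∘ (true ∷_))) (subsetSum-+ (f≈g+h ∘ (false ∷_))))
          (+-interchange _ _ _ _)

  interpolate : ∀ k → (Subset n → Carrier) → (Subset n → Subset n → Carrier) →
                Subset n → Carrier
  interpolate k g e L =
    subsetSum (λ K → if does (∣ K ∣ ℕ.≟ k) then g K * e K L else 0#)

  span-interpolate : (e : Subset n → Subset n → Carrier) →
                     (∀ K → ∣ K ∣ ≡ k → Span k t (e K)) → Span k t (interpolate k g e)
  span-interpolate {k = k} {t = t} {g = g} e se = subsetSum-span λ K → term K (∣ K ∣ ℕ.≟ k)
    where
    term : ∀ K (p? : Dec (∣ K ∣ ≡ k)) → Span k t (λ L → if does p? then g K * e K L else 0#)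
    term K (yes p) = span-scale (g K) (se K p)
    term K (no _) = span-zero

  -- At `L` only the function with index `M` contributes. Point indicators give `M = L`; the
  -- indicators of complements give `M = ∁ L`.
  interpolate-single : ∀ g (e : Subset n → Subset n → Carrier) L M → ∣ M ∣ ≡ k →
    (∀ K → ∣ K ∣ ≡ k → K ≢ M → e K L ≈ 0#) → e M L ≈ 1# → interpolate k g e L ≈ g M
  interpolate-single {k = k} g e L M ∣M∣≡k off on =
    trans (subsetSum-single _ M (λ K → vanish K (∣ K ∣ ℕ.≟ k))) (value (∣ M ∣ ℕ.≟ k))
    where
    vanish : ∀ K (p? : Dec (∣ K ∣ ≡ k)) → K ≢ M → (if does p? then g K * e K L else 0#) ≈ 0#
    vanish K (yes p) K≢M = trans (*-congˡ (off K p K≢M)) (zeroʳ _)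
    vanish K (no _) _ = refl
    value : (p? : Dec (∣ M ∣ ≡ k)) → (if does p? then g M * e M L else 0#) ≈ g M
    value (yes _) = trans (*-congˡ on) (*-identityʳ _)
    value (no ¬p) = contradiction ∣M∣≡k ¬p

  interpolate-+ : ∀ k g (e e′ : Subset n → Subset n → Carrier) L →
    interpolate k g (λ K L → e K L + e′ K L) L ≈ interpolate k g e L + interpolate k g e′ L
  interpolate-+ k g e e′ L = subsetSum-+ λ K → term K (∣ K ∣ ℕ.≟ k)
    where
    term : ∀ K (p? : Dec (∣ K ∣ ≡ k)) →
      (if does p? then g K * (e K L + e′ K L) else 0#) ≈
      (if does p? then g K * e K L else 0#) + (if does p? then g K * e′ K L else 0#)
    term K (yes _) = distribˡ _ _ _
    term K (no _) = sym (+-identityˡ 0#)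

  -- For sets of equal size `K ⊆ L` forces `K ≡ L`, so the pencil of `K` is the indicator of the
  -- point `K`.
  span-full : (g : Subset n → Carrier) → Span k k g
  span-full {n} {k} g =
    span-cong (λ L ∣L∣≡k → interpolate-single g (λ K → between K ⊤) L L ∣L∣≡k
                 (λ K ∣K∣≡k K≢L → between-false λ (K⊆L , _) →
                    K≢L (⊆∧∣∣≡⇒≡ K L K⊆L (≡.trans ∣K∣≡k (≡.sym ∣L∣≡k))))
                 (between-true {A = L} (λ x → x) (⊆-max L)))
      (span-interpolate (λ K → between K ⊤)
        (λ K ∣K∣≡k → ≡.subst (λ t → Span k t (between K ⊤)) ∣K∣≡k (span-pencil K)))

  -- The indicator of `K` is also `[L ⊆ K]`, the product of `1 - x_b` over the `n ∸ k` points `b`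
  -- outside `K`. The double complement fits the form of `DegreeBelow-between`.
  span-full-co : n ∸ k ≤ k → (g : Subset n → Carrier) → Span k (n ∸ k) g
  span-full-co {n} {k} n∸k≤k g =
    span-cong (λ L ∣L∣≡k → interpolate-single g (λ K → between ⊥ (∁ (∁ K))) L L ∣L∣≡k
                 (λ K ∣K∣≡k K≢L → between-false {A = ⊥} λ (_ , L⊆K) →
                    K≢L (≡.sym (⊆∧∣∣≡⇒≡ L K (λ {x} x∈L → ≡.subst (x ∈_) (∁-involutive K) (L⊆K x∈L))
                      (≡.trans ∣L∣≡k (≡.sym ∣K∣≡k)))))
                 (between-true {B = ∁ (∁ L)} (⊆-min L)
                    λ {x} x∈L → ≡.subst (x ∈_) (≡.sym (∁-involutive L)) x∈L))
      (span-interpolate (λ K → between ⊥ (∁ (∁ K))) span-co)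
    where
    span-co : ∀ K → ∣ K ∣ ≡ k → Span k (n ∸ k) (between ⊥ (∁ (∁ K)))
    span-co K ∣K∣≡k =
      span-DegreeBelow n∸k≤k
        (DegreeBelow-mono (s≤s (ℕ.≤-reflexive (∣⊥∣+∣∁p∣ K ∣K∣≡k)))
          (DegreeBelow-between ⊥ (∁ K) (Disjoint-⊥ˡ (∁ K))))

  -- Σ_K g(K) p_{K,∅}(L) = g(L) + g(∁ L), and p_{K,∅} has degree at most |K| − 1 for odd |K|.
  span-complement-symmetric : parity k ≡ 1ℙ → n ∸ k ≡ k → (g : Subset n → Carrier) →
    (∀ L → g (∁ L) ≈ g L) → Span k (k ∸ 1) g
  -- Here `y` is the inverse of 2.
  span-complement-symmetric {k} {n} odd n∸k≡k g g-sym with y , inv ← suc-invertible 1 =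
    span-cong (λ L ∣L∣≡k → trans (*-congˡ (twice L ∣L∣≡k)) (inv (g L)))
      (span-scale y span-pK)
    where
    pK : Subset n → Subset n → Carrier
    pK K = pairedOn K ⊥

    ∣K∣+∣⊥∣ : ∀ K → ∣ K ∣ ≡ k → ∣ K ∣ ℕ.+ ∣ ⊥ {n} ∣ ≡ k
    ∣K∣+∣⊥∣ K ∣K∣≡k = ≡.trans (≡.cong₂ ℕ._+_ ∣K∣≡k (∣⊥∣≡0 n)) (ℕ.+-identityʳ k)

    span-pK : Span k (k ∸ 1) (interpolate k g pK)
    span-pK = span-interpolate pK λ K ∣K∣≡k →
      ≡.subst (λ d → Span k (d ∸ 1) (pK K)) (∣K∣+∣⊥∣ K ∣K∣≡k)
        (span-paired-odd K ⊥ (Disjoint-sym {I = ⊥} (Disjoint-⊥ˡ K))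
          (≡.trans (≡.cong parity (∣K∣+∣⊥∣ K ∣K∣≡k)) odd)
          (ℕ.≤-reflexive (∣K∣+∣⊥∣ K ∣K∣≡k)))

    at-L : ∀ L → ∣ L ∣ ≡ k → interpolate k g (λ K → between K (∁ ⊥)) L ≈ g L
    at-L L ∣L∣≡k = interpolate-single g (λ K → between K (∁ ⊥)) L L ∣L∣≡k
      (λ K ∣K∣≡k K≢L → between-false λ (K⊆L , _) →
        K≢L (⊆∧∣∣≡⇒≡ K L K⊆L (≡.trans ∣K∣≡k (≡.sym ∣L∣≡k))))
      (between-true {A = L} (λ x → x) (λ {x} _ → x∉p⇒x∈∁p (∉⊥ {x = x})))

    -- `L ⊆ ∁ K` means `K ⊆ ∁ L`, and both sides have `k` elements since `n ∸ k ≡ k`; so only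
    -- `K ≡ ∁ L` counts.
    at-∁L : ∀ L → ∣ L ∣ ≡ k → interpolate k g (λ K → between ⊥ (∁ K)) L ≈ g (∁ L)
    at-∁L L ∣L∣≡k = interpolate-single g (λ K → between ⊥ (∁ K)) L (∁ L) ∣∁L∣≡k
      (λ K ∣K∣≡k K≢∁L → between-false {A = ⊥} λ (_ , L⊆∁K) →
        K≢∁L (⊆∧∣∣≡⇒≡ K (∁ L)
          (λ x∈K → x∉p⇒x∈∁p λ x∈L → x∈∁p⇒x∉p (L⊆∁K x∈L) x∈K)
          (≡.trans ∣K∣≡k (≡.sym ∣∁L∣≡k))))
      (between-true {B = ∁ (∁ L)} (⊆-min L) (λ x∈L → x∉p⇒x∈∁p λ x∈∁L → x∈∁p⇒x∉p x∈∁L x∈L))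
      where
      ∣∁L∣≡k : ∣ ∁ L ∣ ≡ k
      ∣∁L∣≡k = ≡.trans (∣∁p∣≡n∸∣p∣ L) (≡.trans (≡.cong (n ∸_) ∣L∣≡k) n∸k≡k)

    twice : ∀ L → ∣ L ∣ ≡ k → interpolate k g pK L ≈ 2 · g L
    twice L ∣L∣≡k = begin
      interpolate k g pK L  ≈⟨ interpolate-+ k g (λ K → between K (∁ ⊥)) (λ K → between ⊥ (∁ K)) L ⟩
      interpolate k g (λ K → between K (∁ ⊥)) L + interpolate k g (λ K → between ⊥ (∁ K)) L
        ≈⟨ +-cong (at-L L ∣L∣≡k) (trans (at-∁L L ∣L∣≡k) (g-sym L)) ⟩
      g L + g L             ≈⟨ +-congˡ (+-identityʳ _) ⟨
      2 · g L               ∎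

  -- Alternating sums over switches

  -- The sign of `σ` is -1 to the number of entries `false`, that is, of switched pairs.
  alternatingSum : ∀ d → (Vec Bool d → Carrier) → Carrier
  alternatingSum zero f = f []
  alternatingSum (suc d) f = alternatingSum d (f ∘ (true ∷_)) + - alternatingSum d (f ∘ (false ∷_))

  alternatingSum-cong : ∀ d {f f′ : Vec Bool d → Carrier} → (∀ σ → f σ ≈ f′ σ) →
                        alternatingSum d f ≈ alternatingSum d f′
  alternatingSum-cong zero eq = eq []
  alternatingSum-cong (suc d) eq =
    +-cong (alternatingSum-cong d (eq ∘ (true ∷_)))
           (-‿cong (alternatingSum-cong d (eq ∘ (false ∷_))))

  alternatingSum-+ : ∀ d (f f′ : Vec Bool d → Carrier) →
    alternatingSum d (λ σ → f σ + f′ σ) ≈ alternatingSum d f + alternatingSum d f′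
  alternatingSum-+ zero f f′ = refl
  alternatingSum-+ (suc d) f f′ =
    trans (+-cong (alternatingSum-+ d _ _)
                  (trans (-‿cong (alternatingSum-+ d _ _)) (sym (-‿+-comm _ _))))
          (+-interchange _ _ _ _)

  alternatingSum-* : ∀ d a (f : Vec Bool d → Carrier) →
    alternatingSum d (λ σ → a * f σ) ≈ a * alternatingSum d f
  alternatingSum-* zero a f = refl
  alternatingSum-* (suc d) a f =
    trans (+-cong (alternatingSum-* d a _)
                  (trans (-‿cong (alternatingSum-* d a _)) (-‿distribʳ-* _ _)))
          (sym (distribˡ a _ _))

  alternatingSum-zero : ∀ d {f : Vec Bool d → Carrier} → (∀ σ → f σ ≈ 0#) →
                        alternatingSum d f ≈ 0#
  alternatingSum-zero zero f≈0 = f≈0 []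
  alternatingSum-zero (suc d) f≈0 =
    trans (+-cong (alternatingSum-zero d (f≈0 ∘ (true ∷_)))
                  (-‿cong (alternatingSum-zero d (f≈0 ∘ (false ∷_)))))
          (-‿inverseʳ 0#)

  alternatingSum-last : ∀ d (f : Vec Bool d → Carrier) →
    (∀ σ → σ ≢ replicate d false → f σ ≈ 0#) →
    alternatingSum d f ≈ sgn d * f (replicate d false)
  alternatingSum-last zero f _ = sym (*-identityˡ _)
  alternatingSum-last (suc d) f f≈0 =
    trans (+-cong (alternatingSum-zero d (λ σ → f≈0 (true ∷ σ) λ ()))
                  (-‿cong (alternatingSum-last d (f ∘ (false ∷_))
                    (λ σ σ≢ → f≈0 (false ∷ σ) (σ≢ ∘ ∷-injectiveʳ)))))
          (trans (+-identityˡ _) (-‿distribˡ-* _ _))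

  -- The induction over the pairs composes a pencil with switches, which leads out of the class of
  -- pencils but keeps control of the relevant points.
  DependsOn : Subset n → (Subset n → Carrier) → Set ℓ₁
  DependsOn {n} T g =
    ∀ (K L : Subset n) → (∀ v → v ∈ T → lookup K v ≡ lookup L v) → g K ≈ g L

  DependsOn-pencil : (T : Subset n) → DependsOn T (between T ⊤)
  DependsOn-pencil T K L K≡L =
    reflexive (≡.cong ⟦_⟧ (does-⇔ (mk⇔ (transport (λ v v∈T → K≡L v v∈T))
                                       (transport (λ v v∈T → ≡.sym (K≡L v v∈T))))
      ((T ⊆? K) ×-dec (K ⊆? ⊤)) ((T ⊆? L) ×-dec (L ⊆? ⊤))))
    where
    transport : ∀ {K L} → (∀ v → v ∈ T → lookup K v ≡ lookup L v) →
                T ⊆ K × K ⊆ ⊤ → T ⊆ L × L ⊆ ⊤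
    transport {K} {L} K≡L (T⊆K , _) =
      (λ {v} v∈T → lookup⇒[]= v L (≡.trans (≡.sym (K≡L v v∈T)) ([]=⇒lookup (T⊆K v∈T)))) ,
      ⊆-max L

  -- A switch overwrites `a` and `b` by constants, so these two points drop out of `T`.
  DependsOn-switch : ∀ {T T′ : Subset n} {g} a b x →
    (∀ {v} → v ∈ T → v ≢ a → v ≢ b → v ∈ T′) →
    DependsOn T g → DependsOn T′ (g ∘ switch a b x)
  DependsOn-switch {T = T} a b x T⊆T′ dep K L K≡L = dep _ _ agree
    where
    agree : ∀ v → v ∈ T → lookup (switch a b x K) v ≡ lookup (switch a b x L) v
    agree v v∈T with v Fin.≟ b | v Fin.≟ a
    ... | yes ≡.refl | _ =
      ≡.trans (lookup∘update b (K [ a ]≔ x) _) (≡.sym (lookup∘update b (L [ a ]≔ x) _))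
    ... | no v≢b | yes ≡.refl =
      ≡.trans (≡.trans (lookup∘update′ v≢b (K [ a ]≔ x) _) (lookup∘update a K x))
        (≡.sym (≡.trans (lookup∘update′ v≢b (L [ a ]≔ x) _) (lookup∘update a L x)))
    ... | no v≢b | no v≢a =
      ≡.trans (lookup-switch x K v≢a v≢b)
        (≡.trans (K≡L v (T⊆T′ v∈T v≢a v≢b)) (≡.sym (lookup-switch x L v≢a v≢b)))

  -- A pair that misses T makes the two halves of the alternating sum equal; a pair that
  -- meets T fixes a point of T, so that the halves depend on fewer points.
  alternatingSum-DependsOn : ∀ {I J C D K T : Subset n} {g} (p : Pairing I J C D d) →
    ∣ T ∣ < d → DependsOn T g → alternatingSum d (g ∘ points K p) ≈ 0#
  alternatingSum-DependsOn {K = K} {T} {g} (pair {d = d} a b a∈C b∈D _ p) ∣T∣<d dep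
    with a ∈? T | b ∈? T
  ... | yes a∈T | _ =
    trans (+-cong (half true) (-‿cong (half false))) (-‿inverseʳ 0#)
    where
    half : ∀ x → alternatingSum d (g ∘ switch a b x ∘ points K p) ≈ 0#
    half x = alternatingSum-DependsOn {T = T - a} p
      (ℕ.≤-trans (x∈p⇒∣p-x∣<∣p∣ a∈T) (ℕ.s≤s⁻¹ ∣T∣<d))
      (DependsOn-switch {T = T} a b x (λ v∈T v≢a _ → x∈p∧x≢y⇒x∈p-y v∈T v≢a) dep)
  ... | no _ | yes b∈T =
    trans (+-cong (half true) (-‿cong (half false))) (-‿inverseʳ 0#)
    where
    half : ∀ x → alternatingSum d (g ∘ switch a b x ∘ points K p) ≈ 0#
    half x = alternatingSum-DependsOn {T = T - b} p
      (ℕ.≤-trans (x∈p⇒∣p-x∣<∣p∣ b∈T) (ℕ.s≤s⁻¹ ∣T∣<d))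
      (DependsOn-switch {T = T} a b x (λ v∈T _ v≢b → x∈p∧x≢y⇒x∈p-y v∈T v≢b) dep)
  ... | no a∉T | no b∉T =
    trans (+-congʳ (alternatingSum-cong d λ σ → dep _ _ (agree σ))) (-‿inverseʳ _)
    where
    agree : ∀ σ v → v ∈ T → lookup (switch a b true (points K p σ)) v ≡
                            lookup (switch a b false (points K p σ)) v
    agree σ v v∈T =
      ≡.trans (lookup-switch true (points K p σ) v≢a v≢b)
              (≡.sym (lookup-switch false (points K p σ) v≢a v≢b))
      where
      v≢a : v ≢ a
      v≢a ≡.refl = a∉T v∈T
      v≢b : v ≢ b
      v≢b ≡.refl = b∉T v∈T

  -- All the switched sets lie on the slice, so the pencil combination can be used at each of them.
  -- By linearity a single pencil remains, and it depends on only `t < d` points.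
  alternatingSum-span : ∀ {I J C D K : Subset n} → Separates K C D → ∣ K ∣ ≡ k →
    (p : Pairing I J C D d) → t < d → Span k t g → alternatingSum d (g ∘ points K p) ≈ 0#
  alternatingSum-span {d = d} {t} {K = K} sep ∣K∣≡k p t<d (m , a , T , eq) =
    trans (alternatingSum-cong d λ σ → eq (points K p σ , ≡.trans (∣points∣ sep p σ) ∣K∣≡k))
          (go m a T)
    where
    go : ∀ m (a : Vector.Vector Carrier m) (T : Vector.Vector (KSubset _ t) m) →
      alternatingSum d (λ σ → sum (λ s → a s * between (proj₁ (T s)) ⊤ (points K p σ))) ≈ 0#
    go zero a T = alternatingSum-zero d λ _ → refl
    go (suc m) a T = begin
      alternatingSum d (λ σ → a zero * f σ + rest σ)
        ≈⟨ alternatingSum-+ d _ _ ⟩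
      alternatingSum d (λ σ → a zero * f σ) + alternatingSum d rest
        ≈⟨ +-cong (alternatingSum-* d _ _) (go m (a ∘ suc) (T ∘ suc)) ⟩
      a zero * alternatingSum d f + 0#
        ≈⟨ +-identityʳ _ ⟩
      a zero * alternatingSum d f
        ≈⟨ *-congˡ (alternatingSum-DependsOn p
             (≡.subst (_< d) (≡.sym (proj₂ (T zero))) t<d) (DependsOn-pencil (proj₁ (T zero)))) ⟩
      a zero * 0#
        ≈⟨ zeroʳ _ ⟩
      0#  ∎
      where
      f rest : Vec Bool d → Carrier
      f σ = between (proj₁ (T zero)) ⊤ (points K p σ)
      rest σ = sum (λ s → a (suc s) * between (proj₁ (T (suc s))) ⊤ (points K p σ))

  -- Switching a pair removes some `a ∈ I` or inserts some `b ∈ J`, so only `K` contributes, with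
  -- sign +1.
  alternatingSum-between : ∀ {I J C D K : Subset n} → Separates K C D → I ⊆ K → K ⊆ ∁ J →
    (p : Pairing I J C D d) → alternatingSum d (between I (∁ J) ∘ points K p) ≈ 1#
  alternatingSum-between sep I⊆K K⊆∁J done = between-true I⊆K K⊆∁J
  alternatingSum-between {I = I} {J} {K = K} sep I⊆K K⊆∁J (pair {d = d} a b a∈C b∈D mark p) =
    begin
      alternatingSum d (between I (∁ J) ∘ switch a b true ∘ points K p) +
      - alternatingSum d (between I (∁ J) ∘ switch a b false ∘ points K p)
        ≈⟨ +-cong (alternatingSum-cong d λ σ → reflexive
                     (≡.cong (between I (∁ J)) (switch-true (a∈ σ) (b∉ σ))))
                  (-‿cong (alternatingSum-zero d λ σ → between-false (bad σ mark))) ⟩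
      alternatingSum d (between I (∁ J) ∘ points K p) + - 0#
        ≈⟨ +-cong (alternatingSum-between (Separates-remove sep a b) I⊆K K⊆∁J p) -0#≈0# ⟩
      1# + 0#
        ≈⟨ +-identityʳ 1# ⟩
      1#  ∎
    where
    a∈ = pair-∈ sep a∈C b∈D p
    b∉ = pair-∉ sep a∈C b∈D p
    bad : ∀ σ → a ∈ I ⊎ b ∈ J → let L = switch a b false (points K p σ) in ¬ (I ⊆ L × L ⊆ ∁ J)
    bad σ (inj₁ a∈I) (I⊆L , _) = a∉switch-false (a∈ σ) (b∉ σ) (I⊆L a∈I)
    bad σ (inj₂ b∈J) (_ , L⊆∁J) = x∈∁p⇒x∉p (L⊆∁J (b∈switch-false (a∈ σ) (b∉ σ))) b∈J

  -- By `violation` a set with an unswitched pair contains a point of `I` or misses a point of `J`;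
  -- only the set with all `d` pairs switched is left.
  alternatingSum-opposite : ∀ {I J C D K : Subset n} → Separates K C D → (p : Pairing I J C D d) →
    alternatingSum d (between J (∁ I) ∘ points K p) ≈
    sgn d * between J (∁ I) (points K p (replicate d false))
  alternatingSum-opposite {d = d} {I} {J} {K = K} sep p =
    alternatingSum-last d _ λ σ σ≢ → between-false (bad σ (violation sep p σ σ≢))
    where
    bad : ∀ σ → ∃ (λ v → _ × (v ∈ I × v ∈ points K p σ ⊎ v ∈ J × v ∉ points K p σ)) →
          ¬ (J ⊆ points K p σ × points K p σ ⊆ ∁ I)
    bad σ (v , _ , inj₁ (v∈I , v∈)) (_ , ⊆∁I) = x∈∁p⇒x∉p (⊆∁I v∈) v∈I
    bad σ (v , _ , inj₂ (v∈J , v∉)) (J⊆ , _) = v∉ (J⊆ v∈J)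

  -- For `t < d` the sum would vanish, but in characteristic 0 a positive integer is apart from 0.
  nonzero⇒≤ : ∀ {I J C D K : Subset n} → Separates K C D → ∣ K ∣ ≡ k → (p : Pairing I J C D d) →
    ∀ m → alternatingSum d (pairedOn I J ∘ points K p) ≈ suc m · 1# →
    ∀ t → Span k t (pairedOn I J) → d ≤ t
  nonzero⇒≤ sep ∣K∣≡k p m value t span = ℕ.≮⇒≥ λ t<d →
    #-irrefl (trans (sym value) (alternatingSum-span sep ∣K∣≡k p t<d span)) (char0 m)

  -- Lower bounds from a set between `I` and the complement of `J`.

  module LowerBound {n k} (I J K : Subset n) (∣K∣≡k : ∣ K ∣ ≡ k)
                    (I⊆K : I ⊆ K) (K⊆∁J : K ⊆ ∁ J) where

    private
      ∣∁K∣≡n∸k : ∣ ∁ K ∣ ≡ n ∸ k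
      ∣∁K∣≡n∸k = ≡.trans (∣∁p∣≡n∸∣p∣ K) (≡.cong (n ∸_) ∣K∣≡k)

      ∣I∣≤∣K∩I∣ : ∣ I ∣ ≤ ∣ K ∩ I ∣
      ∣I∣≤∣K∩I∣ = p⊆q⇒∣p∣≤∣q∣ λ x∈I → x∈p∩q⁺ (I⊆K x∈I , x∈I)

      J⊆∁K : J ⊆ ∁ K
      J⊆∁K x∈J = x∉p⇒x∈∁p λ x∈K → x∈∁p⇒x∉p (K⊆∁J x∈K) x∈J

      ∣J∣≤∣∁K∩J∣ : ∣ J ∣ ≤ ∣ ∁ K ∩ J ∣
      ∣J∣≤∣∁K∩J∣ = p⊆q⇒∣p∣≤∣q∣ λ x∈J → x∈p∩q⁺ (J⊆∁K x∈J , x∈J)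

      sum-value : ∀ {C D} → Separates K C D → (p : Pairing I J C D d) →
        alternatingSum d (pairedOn I J ∘ points K p) ≈
        1# + alternatingSum d (between J (∁ I) ∘ points K p)
      sum-value {d = d} sep p =
        trans (alternatingSum-+ d _ _) (+-congʳ (alternatingSum-between sep I⊆K K⊆∁J p))

    -- For even `d` the second summand cannot cancel the first: the sum is 2 or 1, according to
    -- whether the fully switched set lies between `J` and `∁ I`.
    even-bound : parity d ≡ 0ℙ → d ≤ k → d ≤ n ∸ k → d ≤ ∣ I ∣ ℕ.+ ∣ J ∣ →
                 ∀ t → Span k t (pairedOn I J) → d ≤ t
    even-bound {d} even d≤k d≤n∸k d≤i+j =
      [ nonzero⇒≤ sep ∣K∣≡k p 0 ∘ value 0 , nonzero⇒≤ sep ∣K∣≡k p 1 ∘ value 1 ]′ zero-or-one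
      where
      sep : Separates K K (∁ K)
      sep = (λ v∈K → v∈K) , x∈∁p⇒x∉p
      p : Pairing I J K (∁ K) d
      p = pairing d I J K (∁ K)
        (≡.subst (d ≤_) (≡.sym ∣K∣≡k) d≤k) (≡.subst (d ≤_) (≡.sym ∣∁K∣≡n∸k) d≤n∸k)
        (ℕ.≤-trans d≤i+j (ℕ.+-mono-≤ ∣I∣≤∣K∩I∣ ∣J∣≤∣∁K∩J∣))
      last = between J (∁ I) (points K p (replicate d false))
      zero-or-one : last ≈ 0 · 1# ⊎ last ≈ 1 · 1#
      zero-or-one with does ((J ⊆? points K p (replicate d false)) ×-dec
                             (points K p (replicate d false) ⊆? ∁ I))
      ... | false = inj₁ refl
      ... | true = inj₂ (sym (+-identityʳ 1#))
      value : ∀ m → last ≈ m · 1# → alternatingSum d (pairedOn I J ∘ points K p) ≈ suc m · 1#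
      value m eq = trans (sum-value sep p) (+-congˡ (trans (alternatingSum-opposite sep p)
        (trans (*-congʳ (even⇒sgn≈1 d even)) (trans (*-identityˡ _) eq))))

    private
      -- A point `v` of `I ∪ J` outside all pairs keeps its position relative to `K`, which makes
      -- the second summand vanish on all switched sets. The sum is 1 for either parity of `d`.
      reserved-bound : ∀ {C D v} → Separates K C D → Pairing I J C D d →
        v ∉ C → v ∉ D → v ∈ I ⊎ v ∈ J → ∀ t → Span k t (pairedOn I J) → d ≤ t
      reserved-bound {d = d} sep p v∉C v∉D mark = nonzero⇒≤ sep ∣K∣≡k p 0
        (trans (sum-value sep p)
          (+-congˡ (alternatingSum-zero d λ σ → between-false (bad σ mark))))
        where
        bad : ∀ σ → _ ∈ I ⊎ _ ∈ J → ¬ (J ⊆ points K p σ × points K p σ ⊆ ∁ I)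
        bad σ (inj₁ v∈I) (_ , ⊆∁I) = x∈∁p⇒x∉p (⊆∁I (∈-points p σ v∉C v∉D (I⊆K v∈I))) v∈I
        bad σ (inj₂ v∈J) (J⊆ , _) = ∉-points p σ v∉C v∉D (x∈∁p⇒x∉p (J⊆∁K v∈J)) (J⊆ v∈J)

    -- Reserving `e ∈ I` costs one point of `K` and one mark, hence the two strict inequalities. In
    -- `reserveʳ-bound` the point comes from `J` and is taken from `∁ K`.
    reserveˡ-bound : 0 < ∣ I ∣ → d < k → d ≤ n ∸ k → d < ∣ I ∣ ℕ.+ ∣ J ∣ →
                     ∀ t → Span k t (pairedOn I J) → d ≤ t
    reserveˡ-bound {d} 0<∣I∣ d<k d≤n∸k d<i+j with e , e∈I ← 0<∣p∣⇒Nonempty I 0<∣I∣ =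
      reserved-bound (p-x⊆p K e , x∈∁p⇒x∉p)
        (pairing d I J (K - e) (∁ K)
          (d<∣p∣⇒d≤∣p-x∣ K e (≡.subst (d <_) (≡.sym ∣K∣≡k) d<k))
          (≡.subst (d ≤_) (≡.sym ∣∁K∣≡n∸k) d≤n∸k)
          (ℕ.s≤s⁻¹ (ℕ.≤-trans d<i+j
            (ℕ.+-mono-≤ (ℕ.≤-trans ∣I∣≤∣K∩I∣ (∣p∩q∣≤1+∣p-x∩q∣ K I e)) ∣J∣≤∣∁K∩J∣))))
        (x∉p-x K e) (x∈p⇒x∉∁p (I⊆K e∈I)) (inj₁ e∈I)

    reserveʳ-bound : 0 < ∣ J ∣ → d ≤ k → d < n ∸ k → d < ∣ I ∣ ℕ.+ ∣ J ∣ →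
                     ∀ t → Span k t (pairedOn I J) → d ≤ t
    reserveʳ-bound {d} 0<∣J∣ d≤k d<n∸k d<i+j with e , e∈J ← 0<∣p∣⇒Nonempty J 0<∣J∣ =
      reserved-bound ((λ v∈K → v∈K) , x∈∁p⇒x∉p ∘ p-x⊆p (∁ K) e)
        (pairing d I J K (∁ K - e)
          (≡.subst (d ≤_) (≡.sym ∣K∣≡k) d≤k)
          (d<∣p∣⇒d≤∣p-x∣ (∁ K) e (≡.subst (d <_) (≡.sym ∣∁K∣≡n∸k) d<n∸k))
          (ℕ.s≤s⁻¹ (ℕ.≤-trans d<i+j (ℕ.≤-trans
            (ℕ.+-mono-≤ ∣I∣≤∣K∩I∣ (ℕ.≤-trans ∣J∣≤∣∁K∩J∣ (∣p∩q∣≤1+∣p-x∩q∣ (∁ K) J e)))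
            (ℕ.≤-reflexive (ℕ.+-suc _ _))))))
        (x∈∁p⇒x∉p (J⊆∁K e∈J)) (x∉p-x (∁ K) e) (inj₂ e∈J)

    private
      ∣I∣≤k : ∣ I ∣ ≤ k
      ∣I∣≤k = ≡.subst (∣ I ∣ ≤_) ∣K∣≡k (p⊆q⇒∣p∣≤∣q∣ I⊆K)

      ∣J∣≤n∸k : ∣ J ∣ ≤ n ∸ k
      ∣J∣≤n∸k = ≡.subst (∣ J ∣ ≤_) ∣∁K∣≡n∸k (p⊆q⇒∣p∣≤∣q∣ J⊆∁K)

    strict-bound : d < k → d < n ∸ k → d < ∣ I ∣ ℕ.+ ∣ J ∣ →
                   ∀ t → Span k t (pairedOn I J) → d ≤ t
    strict-bound d<k d<n∸k d<i+j with 0 ℕ.<? ∣ I ∣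
    ... | yes 0<∣I∣ = reserveˡ-bound 0<∣I∣ d<k (ℕ.<⇒≤ d<n∸k) d<i+j
    ... | no 0≮∣I∣ =
      reserveʳ-bound (m≤d<m+n⇒0<n (ℕ.≤-trans (ℕ.≮⇒≥ 0≮∣I∣) z≤n) d<i+j) (ℕ.<⇒≤ d<k) d<n∸k d<i+j

    pairedDegree-bound : k ≤ n → ∀ t → Span k t (pairedOn I J) → pairedDegree n k ∣ I ∣ ∣ J ∣ ≤ t
    pairedDegree-bound k≤n =
      pairedDegree-elim (λ d → ∀ t → Span k t (pairedOn I J) → d ≤ t) n k ∣ I ∣ ∣ J ∣
        -- In the first two cases the degree is smaller than `k`, `n ∸ k` and `∣ I ∣ + ∣ J ∣`, so a
        -- point can be reserved on whichever side has one.
        (λ (odd , s≤) → strict-bound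
          (ℕ.≤-trans (odd⇒∸1< odd) (ℕ.≤-trans s≤ (ℕ.m⊓n≤m k (n ∸ k))))
          (ℕ.≤-trans (odd⇒∸1< odd) (ℕ.≤-trans s≤ (ℕ.m⊓n≤n k (n ∸ k))))
          (odd⇒∸1< odd))
        (λ (odd , n≡2k , k≤s) → strict-bound
          (odd⇒∸1< odd)
          (≡.subst (k ∸ 1 <_) (≡.sym (n≡2k⇒n∸k≡k k n≡2k)) (odd⇒∸1< odd))
          (ℕ.≤-trans (odd⇒∸1< odd) k≤s))
        generic
      where
      s = ∣ I ∣ ℕ.+ ∣ J ∣
      δ = s ⊓ k ⊓ (n ∸ k)

      δ≤s : δ ≤ s
      δ≤s = ℕ.≤-trans (ℕ.m⊓n≤m (s ⊓ k) (n ∸ k)) (ℕ.m⊓n≤m s k)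
      δ≤k : δ ≤ k
      δ≤k = ℕ.≤-trans (ℕ.m⊓n≤m (s ⊓ k) (n ∸ k)) (ℕ.m⊓n≤n s k)
      δ≤n∸k : δ ≤ n ∸ k
      δ≤n∸k = ℕ.m⊓n≤n (s ⊓ k) (n ∸ k)

      generic : ¬ (parity s ≡ 1ℙ × s ≤ k ⊓ (n ∸ k)) → ¬ (parity k ≡ 1ℙ × n ≡ 2 ℕ.* k × k ≤ s) →
                ∀ t → Span k t (pairedOn I J) → δ ≤ t
      generic ¬first ¬second with parity δ in parity-δ
      ... | 0ℙ = even-bound parity-δ δ≤k δ≤n∸k δ≤s
      -- An odd `δ` requires a reserved point. Since the first case is excluded, `s` exceeds the
      -- smaller of `k` and `n ∸ k`; since the second is excluded, these two differ, and the larger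
      -- side has a point to spare.
      ... | 1ℙ with s ℕ.≤? k ⊓ (n ∸ k)
      ...   | yes s≤ = contradiction (≡.trans (≡.cong parity (≡.sym δ≡s)) parity-δ , s≤) ¬first
        where
        δ≡s : δ ≡ s
        δ≡s = ≡.trans (ℕ.⊓-assoc s k (n ∸ k)) (ℕ.m≤n⇒m⊓n≡m s≤)
      ...   | no s≰ with ℕ.<-cmp k (n ∸ k)
      -- `J` is non-empty because `∣ I ∣ ≤ k < s`.
      ...     | tri< k<n∸k _ _ = reserveʳ-bound (m≤d<m+n⇒0<n ∣I∣≤k k<s) δ≤k
                  (ℕ.≤-trans (s≤s δ≤k) k<n∸k) (ℕ.≤-trans (s≤s δ≤k) k<s)
        where
        k<s : k < s
        k<s = ≡.subst (_< s) (ℕ.m≤n⇒m⊓n≡m (ℕ.<⇒≤ k<n∸k)) (ℕ.≰⇒> s≰)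
      -- `I` is non-empty because `∣ J ∣ ≤ n ∸ k < s`.
      ...     | tri> _ _ n∸k<k = reserveˡ-bound
                  (m≤d<m+n⇒0<n ∣J∣≤n∸k (≡.subst (n ∸ k <_) (ℕ.+-comm ∣ I ∣ ∣ J ∣) n∸k<s))
                  (ℕ.≤-trans (s≤s δ≤n∸k) n∸k<k) δ≤n∸k (ℕ.≤-trans (s≤s δ≤n∸k) n∸k<s)
        where
        n∸k<s : n ∸ k < s
        n∸k<s = ≡.subst (_< s) (ℕ.m≥n⇒m⊓n≡n (ℕ.<⇒≤ n∸k<k)) (ℕ.≰⇒> s≰)
      ...     | tri≈ _ k≡n∸k _ = contradiction
                  (≡.trans (≡.cong parity (≡.sym δ≡k)) parity-δ , n∸k≡k⇒n≡2k k≤n k≡n∸k , k≤s) ¬second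
        where
        k≤s : k ≤ s
        k≤s = ℕ.<⇒≤ (≡.subst (_< s) (ℕ.m≤n⇒m⊓n≡m (ℕ.≤-reflexive k≡n∸k)) (ℕ.≰⇒> s≰))
        δ≡k : δ ≡ k
        δ≡k = ≡.trans (≡.cong (_⊓ (n ∸ k)) (ℕ.m≥n⇒m⊓n≡n k≤s))
                      (ℕ.m≤n⇒m⊓n≡m (ℕ.≤-reflexive k≡n∸k))

  -- Complement symmetry and the degree of the paired function.

  between-∁ : (I J L : Subset n) → between I (∁ J) (∁ L) ≡ between J (∁ I) L
  between-∁ I J L = ≡.cong ⟦_⟧ (does-⇔ (mk⇔ to from)
    ((I ⊆? ∁ L) ×-dec (∁ L ⊆? ∁ J)) ((J ⊆? L) ×-dec (L ⊆? ∁ I)))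
    where
    to : I ⊆ ∁ L × ∁ L ⊆ ∁ J → J ⊆ L × L ⊆ ∁ I
    to (I⊆∁L , ∁L⊆∁J) = ∁p⊆∁q⇒p⊇q ∁L⊆∁J ,
      λ x∈L → x∉p⇒x∈∁p λ x∈I → x∈∁p⇒x∉p (I⊆∁L x∈I) x∈L
    from : J ⊆ L × L ⊆ ∁ I → I ⊆ ∁ L × ∁ L ⊆ ∁ J
    from (J⊆L , L⊆∁I) =
      (λ x∈I → x∉p⇒x∈∁p λ x∈L → x∈∁p⇒x∉p (L⊆∁I x∈L) x∈I) , p⊆q⇒∁p⊇∁q J⊆L

  -- Complementation exchanges the two summands.
  pairedOn-∁ : (I J L : Subset n) → pairedOn I J (∁ L) ≈ pairedOn I J L
  pairedOn-∁ I J L = trans (+-cong (reflexive (between-∁ I J L)) (reflexive (between-∁ J I L)))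
                           (+-comm _ _)

  span-pairedDegree : (I J : Subset n) → Disjoint I J →
                      Span k (pairedDegree n k ∣ I ∣ ∣ J ∣) (pairedOn I J)
  span-pairedDegree {n} {k} I J I#J =
    pairedDegree-elim (λ d → Span k d (pairedOn I J)) n k ∣ I ∣ ∣ J ∣
      (λ (odd , s≤) → span-paired-odd I J I#J odd (ℕ.≤-trans s≤ (ℕ.m⊓n≤m k (n ∸ k))))
      (λ (odd , n≡2k , _) →
        span-complement-symmetric odd (n≡2k⇒n∸k≡k k n≡2k) (pairedOn I J) (pairedOn-∁ I J))
      -- Each argument of the minimum is handled where it is attained: `s` by expansion, `k` and
      -- `n ∸ k` by the two forms of the point indicators.
      (λ _ _ → ⊓-elim (λ d → Span k d (pairedOn I J)) (s ⊓ k) (n ∸ k)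
        (λ _ → ⊓-elim (λ d → Span k d (pairedOn I J)) s k
          (span-paired I J I#J) (λ _ → span-full (pairedOn I J)))
        (λ n∸k≤ → span-full-co (ℕ.≤-trans n∸k≤ (ℕ.m⊓n≤n s k)) (pairedOn I J)))
    where s = ∣ I ∣ ℕ.+ ∣ J ∣

  -- A finite search decides whether some `K` of the slice satisfies `I ⊆ K ⊆ ∁ J` or the same with
  -- `I` and `J` exchanged, although equality in the field may be undecidable. If there is none,
  -- both summands vanish everywhere.
  pairedDegree-minimal : k ≤ n → (I J : Subset n) → ¬ IsZero F (paired F k I J) →
    ∀ t → Span k t (pairedOn I J) → pairedDegree n k ∣ I ∣ ∣ J ∣ ≤ t
  pairedDegree-minimal {k} {n} k≤n I J p≢0 t span with separated? I J | separated? J I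
    where
    separated? : (I J : Subset n) → Dec (∃ λ K → ∣ K ∣ ≡ k × I ⊆ K × K ⊆ ∁ J)
    separated? I J = anySubset? λ K → (∣ K ∣ ℕ.≟ k) ×-dec (I ⊆? K) ×-dec (K ⊆? ∁ J)
  ... | yes (K , ∣K∣≡k , I⊆K , K⊆∁J) | _ =
    LowerBound.pairedDegree-bound I J K ∣K∣≡k I⊆K K⊆∁J k≤n t span
  ... | no _ | yes (K , ∣K∣≡k , J⊆K , K⊆∁I) =
    ≡.subst (_≤ t) (pairedDegree-comm n k ∣ J ∣ ∣ I ∣)
      (LowerBound.pairedDegree-bound J I K ∣K∣≡k J⊆K K⊆∁I k≤n t
        (span-cong (λ _ _ → +-comm _ _) span))
  ... | no ¬IJ | no ¬JI = contradiction
    (λ (K , ∣K∣≡k) → trans (+-cong (between-false λ (I⊆K , K⊆∁J) → ¬IJ (K , ∣K∣≡k , I⊆K , K⊆∁J))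
                                   (between-false λ (J⊆K , K⊆∁I) → ¬JI (K , ∣K∣≡k , J⊆K , K⊆∁I)))
                           (+-identityˡ 0#))
    p≢0

theorem1 : ∀ {c ℓ₁ ℓ₂} (F : HeytingField c ℓ₁ ℓ₂) → CharacteristicZero F →
    (n k : ℕ) → k ≤ n →
    (I J : Subset n) → Disjoint I J →
    ¬ IsZero F (paired F k I J) →
    HasDegree F (paired F k I J) [ pairedDegree n k ∣ I ∣ ∣ J ∣ ]
theorem1 F char0 n k k≤n I J I#J p≢0 =
  p≢0 , span-pairedDegree I J I#J , pairedDegree-minimal k≤n I J p≢0
  where open Degree F char0
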